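{- For every real $P>0$ and $C>0$ there is $M=M(P,C)$ such that every graph $G$ with $$\chi(G)\ge M,\qquad e(G)\le C\,\chi(G)^P$$ contains a subgraph of girth at least $5$ and chromatic number at least $4$. In particular, every triangle-free graph $G$ of sufficiently high chromatic number (depending on $P,C$) satisfying $e(G)\le C\chi(G)^P$ contains a $C_4$-free $4$-chromatic subgraph.
   Context: All graphs are finite and simple; subgraphs need not be induced. $\chi$ is the chromatic number, $e(G)$ the number of edges. The girth of a forest is $\infty$. $C_4$-free means containing no cycle of length $4$. -}

module Defs where

open import Data.Empty using (⊥-elim)
open import Data.Fin.Base as Fin using (Fin; toℕ; finToFun; funToFin)
import Data.Fin.Properties as Fin
open import Data.Integer.Base as ℤ using ()
open import Data.List.Base using (allFin; cartesianProduct; filter; length)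
open import Data.Nat.Base as ℕ using (ℕ; zero; suc; z≤n; s≤s)
import Data.Nat.Properties as ℕ
open import Data.Product.Base using (_×_; _,_; ∃; ∃-syntax; proj₁)
open import Data.Rational.Base as ℚ using (ℚ; 0ℚ; ↥_; ↧ₙ_)
open import Data.Sum.Base using (_⊎_)
open import Function.Base using (id; _∘_)
open import Function.Bundles using (_⇔_)
open import Function.Definitions using (Injective)
open import Level using (0ℓ)
open import Relation.Binary.Core using (Rel)
open import Relation.Binary.Definitions as B using (Symmetric; Irreflexive)
open import Relation.Binary.PropositionalEquality
open import Relation.Nullary using (¬_; Dec; yes; no)
open import Relation.Nullary.Construct.Add.Supremum using (_⁺; [_]; ⊤⁺)
open import Relation.Nullary.Decidable using (map′; _×-dec_; _⊎-dec_; _→-dec_; ¬?)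
open import Relation.Unary using (Pred; Decidable; _∈_)

open import Algebra.Definitions.RawSemiring ℚ.+-*-rawSemiring
  using () renaming (_^_ to _^ℚ_)

------------------------------------------------------------------------
-- Real numbers

-- Two-sided Dedekind cuts: `q ∈ Lower` means q < x and `q ∈ Upper` means x < q.
record ℝ : Set₁ where
  field
    Lower Upper     : Pred ℚ 0ℓ
    lower-inhabited : ∃[ q ] q ∈ Lower
    upper-inhabited : ∃[ q ] q ∈ Upper
    lower-rounded   : ∀ q → q ∈ Lower ⇔ (∃[ r ] (q ℚ.< r × r ∈ Lower))
    upper-rounded   : ∀ r → r ∈ Upper ⇔ (∃[ q ] (q ℚ.< r × q ∈ Upper))
    disjoint        : ∀ q → ¬ (q ∈ Lower × q ∈ Upper)
    located         : ∀ {q r} → q ℚ.< r → q ∈ Lower ⊎ r ∈ Upper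

open ℝ public using (Lower; Upper)

Positive : ℝ → Set
Positive x = 0ℚ ∈ Lower x

fromℕ : ℕ → ℚ
fromℕ n = ℤ.+ n ℚ./ 1

-- A bound q ≤ x with q rational only involves the upper cut of x, so the
-- non-negative real C · n ^ P is represented by its upper cut.

-- The upper cut of n ^ P for a positive real P.  Since
-- n ^ P = inf { n ^ p ∣ p rational, P < p }, a rational y > 0 lies above n ^ P
-- iff n ^ (a / b) < y, i.e. n ^ a < y ^ b, for some fraction a / b > P.
-- As P is positive, so is the numerator a, hence the absolute value is harmless.
_^ᵁ_ : ℕ → ℝ → Pred ℚ 0ℓ
(n ^ᵁ P) y = 0ℚ ℚ.< y × ∃[ p ] (p ∈ Upper P × (fromℕ n ^ℚ ℤ.∣ ↥ p ∣) ℚ.< (y ^ℚ ↧ₙ p))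

-- The upper cut of C · x for a positive real C and a non-negative real x
-- with upper cut U.
_*ᵁ_ : ℝ → Pred ℚ 0ℓ → Pred ℚ 0ℓ
(C *ᵁ U) z = ∃[ c ] ∃[ y ] (c ∈ Upper C × y ∈ U × z ≡ c ℚ.* y)

_≤ᵁ_ : ℚ → Pred ℚ 0ℓ → Set
q ≤ᵁ U = ∀ {z} → z ∈ U → q ℚ.≤ z

infixr 8 _^ᵁ_
infixl 7 _*ᵁ_
infix  4 _≤ᵁ_

------------------------------------------------------------------------
-- Finite searches

least : ∀ {P : Pred ℕ 0ℓ} → Decidable P → ∃ P → ∃[ k ] (P k × (∀ {j} → P j → k ℕ.≤ j))
least {P} P? (n , pn) = go P? n pn
  where
  go : ∀ {P : Pred ℕ 0ℓ} → Decidable P → ∀ n → P n →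
       ∃[ k ] (P k × (∀ {j} → P j → k ℕ.≤ j))
  go P? n pn with P? 0
  go P? n pn | yes p0 = 0 , p0 , λ _ → z≤n
  go P? zero pn | no ¬p0 = ⊥-elim (¬p0 pn)
  go {P} P? (suc n) pn | no ¬p0 with go (λ k → P? (suc k)) n pn
  ... | k , pk , min = suc k , pk , bound
    where
    bound : ∀ {j} → P j → suc k ℕ.≤ j
    bound {zero}  p0 = ⊥-elim (¬p0 p0)
    bound {suc j} pj = s≤s (min pj)

anyFun? : ∀ {m n} {P : Pred (Fin m → Fin n) 0ℓ} →
          (∀ {f g} → f ≗ g → P f → P g) → Decidable P → Dec (∃ P)
anyFun? resp P? = map′
  (λ (i , pi) → finToFun i , pi)
  (λ (f , pf) → funToFin f , resp (sym ∘ Fin.finToFun-funToFin f) pf)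
  (Fin.any? (P? ∘ finToFun))

------------------------------------------------------------------------
-- Finite simple graphs

record Graph : Set₁ where
  field
    order      : ℕ
    Adj        : Rel (Fin order) 0ℓ
    adj?       : B.Decidable Adj
    adj-sym    : Symmetric Adj
    adj-irrefl : Irreflexive _≡_ Adj

  Vertex : Set
  Vertex = Fin order

open Graph using (order; Adj; adj?; Vertex)

e : Graph → ℕ
e G = length (filter (λ (u , v) → (u Fin.<? v) ×-dec adj? G u v)
                     (cartesianProduct (allFin (order G)) (allFin (order G))))

-- H is, up to isomorphism, a not necessarily induced subgraph of G.
_⊆ᴳ_ : Graph → Graph → Set
H ⊆ᴳ G = ∃[ f ] (Injective _≡_ _≡_ f × (∀ {u v} → Adj H u v → Adj G (f u) (f v)))

infix 4 _⊆ᴳ_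

------------------------------------------------------------------------
-- Chromatic number

IsColoring : ∀ G k → (Vertex G → Fin k) → Set
IsColoring G k c = ∀ u v → Adj G u v → c u ≢ c v

Colorable : Graph → ℕ → Set
Colorable G k = ∃ (IsColoring G k)

colorable? : ∀ G → Decidable (Colorable G)
colorable? G k = anyFun?
  (λ f≗g col u v uv eq → col u v uv (trans (f≗g u) (trans eq (sym (f≗g v)))))
  (λ c → Fin.all? λ u → Fin.all? λ v → adj? G u v →-dec ¬? (c u Fin.≟ c v))

order-colorable : ∀ G → Colorable G (order G)
order-colorable G = id , λ u v uv u≡v → Graph.adj-irrefl G u≡v uv

χ : Graph → ℕ
χ G = proj₁ (least (colorable? G) (order G , order-colorable G))

------------------------------------------------------------------------
-- Cycles and girth

-- j is the cyclic successor of i.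
Next : ∀ {k} → Rel (Fin k) 0ℓ
Next {k} i j = toℕ j ≡ suc (toℕ i) ⊎ (suc (toℕ i) ≡ k × toℕ j ≡ 0)

IsCycle : ∀ G k → (Fin k → Vertex G) → Set
IsCycle G k c = (∀ i j → c i ≡ c j → i ≡ j) × (∀ i j → Next i j → Adj G (c i) (c j))

HasCycle : Graph → ℕ → Set
HasCycle G k = 3 ℕ.≤ k × ∃ (IsCycle G k)

hasCycle? : ∀ G → Decidable (HasCycle G)
hasCycle? G k = (3 ℕ.≤? k) ×-dec anyFun?
  (λ f≗g (inj , adj) →
      (λ i j eq → inj i j (trans (f≗g i) (trans eq (sym (f≗g j)))))
    , (λ i j nx → subst₂ (Adj G) (f≗g i) (f≗g j) (adj i j nx)))
  (λ c → (Fin.all? λ i → Fin.all? λ j → (c i Fin.≟ c j) →-dec (i Fin.≟ j))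
   ×-dec (Fin.all? λ i → Fin.all? λ j →
     ((toℕ j ℕ.≟ suc (toℕ i)) ⊎-dec ((suc (toℕ i) ℕ.≟ k) ×-dec (toℕ j ℕ.≟ 0)))
       →-dec adj? G (c i) (c j)))

cycle-length≤order : ∀ G {k} → HasCycle G k → k ℕ.≤ order G
cycle-length≤order G (_ , _ , inj , _) = Fin.injective⇒≤ (λ {i} {j} → inj i j)

anyCycle? : ∀ G → Dec (∃ (HasCycle G))
anyCycle? G = map′
  (λ (k , _ , hk) → k , hk)
  (λ (k , hk) → k , s≤s (cycle-length≤order G hk) , hk)
  (ℕ.anyUpTo? (hasCycle? G) (suc (order G)))

ℕ∞ : Set
ℕ∞ = ℕ ⁺

open import Relation.Binary.Construct.Add.Supremum.NonStrict ℕ._≤_ public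
  using () renaming (_≤⁺_ to _≤∞_)

girth : Graph → ℕ∞
girth G with anyCycle? G
... | yes cyc = [ proj₁ (least (hasCycle? G) cyc) ]
... | no  _   = ⊤⁺

TriangleFree C₄-Free : Graph → Set
TriangleFree G = ¬ HasCycle G 3
C₄-Free      G = ¬ HasCycle G 4

{-# OPTIONS --safe #-}

-- Fix a scale K and say that G, with n vertices, m edges and χ(G) ≥ 4k, is rich
-- if n m < K |W| e(W) for every W with χ(G[W]) > k.  If G is not rich, pass to a
-- violating G[W]: χ drops by a factor of at most 4 while n m drops by a factor of
-- at least K.  As initially n m < K ^ R, where R depends on P only and K is about
-- χ ^ (1/9), a rich subgraph is reached after fewer than R such steps, and there k
-- is still at least 4096 K ^ 8.
--
-- In a rich G, a greedy choice of edges kills all 3-colourings.  Given the edges H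
-- chosen so far, call a vertex saturated if its H-degree is at least D = 8 K ^ 2.
-- The saturated vertices are so few that they induce a k-colourable graph; hence
-- for every 3-colouring some colour class W of the unsaturated vertices has
-- χ(G[W]) > k and more than m / K edges, all of them monochromatic.  At most
-- half of these edges close a triangle or a 4-cycle with H, so averaging yields an
-- edge which closes none and is monochromatic for a fraction 1 / 2K of the
-- 3-colourings that still survive.  After 4 K n such steps no 3-colouring is left.

module Submission where

open import Defs
open import Data.Bool.Base using (if_then_else_)
open import Data.Empty using (⊥; ⊥-elim)
open import Data.Fin.Base as Fin using (Fin; zero; suc; toℕ)
import Data.Fin.Properties as Fin
open import Data.Integer.Base as ℤ using (+≤+; +<+; -≤+)
import Data.Integer.Properties as ℤ
open import Data.List.Base as List
  using (List; []; _∷_; _++_; map; filter; length; cartesianProduct; cartesianProductWith; concatMap; allFin)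
import Data.List.Membership.DecPropositional as DecMembership
open import Data.List.Membership.Propositional using (_∈_; _∉_; find)
open import Data.List.Membership.Propositional.Properties
open import Data.List.Properties using (map-∘; map-++; length-++; length-map; length-tabulate)
open import Data.List.Relation.Binary.Sublist.Propositional using (_⊆_; []; _∷_; _∷ʳ_; lookup; ⊆-refl)
open import Data.List.Relation.Binary.Sublist.Propositional.Properties
  using (filter-⊆; ∷ˡ⁻; map⁺; ++⁺; ++⁺ˡ; All-resp-⊆; length-mono-≤) renaming (filter⁺ to ⊆-filter⁺)
open import Data.List.Relation.Unary.All as All using (All; []; _∷_)
open import Data.List.Relation.Unary.Any as Any using (Any; here; there; index)
open import Data.List.Relation.Unary.Any.Properties using (lookup-index)
open import Data.List.Relation.Unary.Unique.Propositional using (Unique; []; _∷_)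
open import Data.List.Relation.Unary.Unique.Propositional.Properties using (allFin⁺)
open import Data.Nat.Base
open import Data.Nat.ListAction using (sum)
open import Data.Nat.ListAction.Properties using (sum-++)
open import Data.Nat.Properties
open import Data.Nat.Tactic.RingSolver using (solve-∀)
open import Data.Product.Base using (_×_; _,_; ∃-syntax; proj₁; proj₂)
open import Data.Rational.Base as ℚ using (ℚ; 0ℚ; ↥_; ↧ₙ_; toℚᵘ)
import Data.Rational.Properties as ℚ
open import Data.Rational.Unnormalised.Base as ℚᵘ using (mkℚᵘ)
import Data.Rational.Unnormalised.Properties as ℚᵘ
open import Data.Sum.Base using (_⊎_; inj₁; inj₂)
open import Data.Vec.Functional using (updateAt)
open import Data.Vec.Functional.Properties using (updateAt-updates; updateAt-minimal)
open import Function.Base using (_∘_; const; id)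
open import Level using (0ℓ)
open import Relation.Binary.Definitions using (tri<; tri≈; tri>)
open import Relation.Binary.PropositionalEquality
open import Relation.Nullary using (¬_; Dec; yes; no; does; contradiction)
open import Relation.Nullary.Construct.Add.Supremum using ([_])
open import Relation.Nullary.Decidable using (map′; _×-dec_; _⊎-dec_; ¬?; decidable-stable)
open import Relation.Unary using (Pred; Decidable)

open import Algebra.Definitions.RawSemiring ℚ.+-*-rawSemiring using () renaming (_^_ to _^ℚ_)

open Graph using (order; Adj; adj?; Vertex)
open _≤∞_

private variable
  A B : Set
  P : Set

-- Finite sums

∑ : List A → (A → ℕ) → ℕ
∑ xs f = sum (map f xs)

∑-mono : ∀ (xs : List A) {f g : A → ℕ} → (∀ {x} → x ∈ xs → f x ≤ g x) → ∑ xs f ≤ ∑ xs g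
∑-mono []       f≤g = z≤n
∑-mono (x ∷ xs) f≤g = +-mono-≤ (f≤g (here refl)) (∑-mono xs (f≤g ∘ there))

∑-+ : ∀ (xs : List A) (f g : A → ℕ) → ∑ xs (λ x → f x + g x) ≡ ∑ xs f + ∑ xs g
∑-+ []       f g = refl
∑-+ (x ∷ xs) f g rewrite ∑-+ xs f g = shuffle (f x) (g x) (∑ xs f) (∑ xs g)
  where
  shuffle : ∀ a b c d → a + b + (c + d) ≡ a + c + (b + d)
  shuffle = solve-∀

∑-* : ∀ (xs : List A) k (f : A → ℕ) → ∑ xs (λ x → k * f x) ≡ k * ∑ xs f
∑-* []       k f = sym (*-zeroʳ k)
∑-* (x ∷ xs) k f rewrite ∑-* xs k f = sym (*-distribˡ-+ k (f x) (∑ xs f))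

∑-const : ∀ (xs : List A) k → ∑ xs (const k) ≡ length xs * k
∑-const []       k = refl
∑-const (x ∷ xs) k = cong (k +_) (∑-const xs k)

∑-one : ∀ (xs : List A) → ∑ xs (const 1) ≡ length xs
∑-one xs = trans (∑-const xs 1) (*-identityʳ _)

∑-swap : ∀ (xs : List A) (ys : List B) (f : A → B → ℕ) →
         ∑ xs (λ x → ∑ ys (f x)) ≡ ∑ ys (λ y → ∑ xs (λ x → f x y))
∑-swap []       ys f = sym (trans (∑-const ys 0) (*-zeroʳ (length ys)))
∑-swap (x ∷ xs) ys f = trans (cong (∑ ys (f x) +_) (∑-swap xs ys f))
                             (sym (∑-+ ys (f x) (λ y → ∑ xs (λ x → f x y))))

∑-⊆ : ∀ {xs ys : List A} (f : A → ℕ) → xs ⊆ ys → ∑ xs f ≤ ∑ ys f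
∑-⊆ f []         = z≤n
∑-⊆ f (y ∷ʳ τ)   = m≤n⇒m≤o+n (f y) (∑-⊆ f τ)
∑-⊆ f (refl ∷ τ) = +-monoʳ-≤ _ (∑-⊆ f τ)

∑-× : ∀ (xs : List A) (ys : List B) (f : A × B → ℕ) →
       ∑ (cartesianProduct xs ys) f ≡ ∑ xs (λ x → ∑ ys (λ y → f (x , y)))
∑-× []       ys f = refl
∑-× (x ∷ xs) ys f = begin
  ∑ (map (x ,_) ys ++ cartesianProduct xs ys) f
    ≡⟨ cong sum (map-++ f (map (x ,_) ys) _) ⟩
  sum (map f (map (x ,_) ys) ++ map f (cartesianProduct xs ys))
    ≡⟨ sum-++ (map f (map (x ,_) ys)) _ ⟩
  ∑ (map (x ,_) ys) f + ∑ (cartesianProduct xs ys) f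
    ≡⟨ cong₂ _+_ (cong sum (sym (map-∘ ys))) (∑-× xs ys f) ⟩
  ∑ ys (λ y → f (x , y)) + ∑ xs (λ x → ∑ ys (λ y → f (x , y))) ∎
  where open ≡-Reasoning

large-summand : ∀ (xs : List A) (f : A → ℕ) b → 0 < length xs → length xs * b ≤ ∑ xs f →
                ∃[ x ] (x ∈ xs × b ≤ f x)
large-summand (x ∷ []) f b _ le = x , here refl ,
  subst₂ _≤_ (+-identityʳ b) (+-identityʳ (f x)) le
large-summand (x ∷ y ∷ xs) f b _ le with b ≤? f x | large-summand (y ∷ xs) f b (s≤s z≤n)
... | yes b≤fx | _   = x , here refl , b≤fx
... | no  b≰fx | rec = let z , z∈ , b≤fz = rec (≮⇒≥ λ lt → <⇒≱ (+-mono-<-≤ (≰⇒> b≰fx) (<⇒≤ lt)) le)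
                       in z , there z∈ , b≤fz

-- Counting

𝟙 : Dec P → ℕ
𝟙 p? = if does p? then 1 else 0

𝟙-yes : (p? : Dec P) → P → 1 ≤ 𝟙 p?
𝟙-yes (yes _) _ = ≤-refl
𝟙-yes (no ¬p) p = contradiction p ¬p

𝟙-bound : ∀ {n} (p? : Dec P) → (P → 1 ≤ n) → 𝟙 p? ≤ n
𝟙-bound (yes p) h = h p
𝟙-bound (no _)  h = z≤n

length-filter : ∀ {P : Pred A 0ℓ} (P? : Decidable P) xs → length (filter P? xs) ≡ ∑ xs (𝟙 ∘ P?)
length-filter P? []       = refl
length-filter P? (x ∷ xs) with P? x
... | yes _ = cong suc (length-filter P? xs)
... | no  _ = length-filter P? xs

summand≤∑ : ∀ {x} {xs : List A} (f : A → ℕ) → x ∈ xs → f x ≤ ∑ xs f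
summand≤∑ f (here refl) = m≤m+n _ _
summand≤∑ f (there x∈)  = m≤n⇒m≤o+n _ (summand≤∑ f x∈)

-- Markov's inequality in counting form; it bounds the number of vertices of large degree by a sum
-- of degrees.
∑-filter : ∀ {P : Pred A 0ℓ} (P? : Decidable P) xs (f : A → ℕ) {b} →
           (∀ {x} → x ∈ xs → P x → b ≤ f x) → b * length (filter P? xs) ≤ ∑ xs f
∑-filter P? xs f {b} h = begin
  b * length (filter P? xs)   ≡⟨ *-comm b _ ⟩
  length (filter P? xs) * b   ≡⟨ ∑-const (filter P? xs) b ⟨
  ∑ (filter P? xs) (const b)  ≤⟨ ∑-mono (filter P? xs) (λ x∈ → let x∈ , px = ∈-filter⁻ P? x∈ in h x∈ px) ⟩
  ∑ (filter P? xs) f          ≤⟨ ∑-⊆ f (filter-⊆ P? xs) ⟩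
  ∑ xs f                      ∎
  where open ≤-Reasoning

Unique-⊆ : {xs ys : List A} → xs ⊆ ys → Unique ys → Unique xs
Unique-⊆ []         []       = []
Unique-⊆ (y ∷ʳ τ)   (_ ∷ u)  = Unique-⊆ τ u
Unique-⊆ (refl ∷ τ) (y∉ ∷ u) = All-resp-⊆ τ y∉ ∷ Unique-⊆ τ u

cartesianProduct-⊆ : {xs xs′ : List A} {ys ys′ : List B} → xs ⊆ xs′ → ys ⊆ ys′ →
                     cartesianProduct xs ys ⊆ cartesianProduct xs′ ys′
cartesianProduct-⊆ []         σ = []
cartesianProduct-⊆ {ys′ = ys′} (x ∷ʳ τ) σ = ++⁺ˡ (map (x ,_) ys′) (cartesianProduct-⊆ τ σ)
cartesianProduct-⊆ (refl ∷ τ) σ = ++⁺ (map⁺ _ σ) (cartesianProduct-⊆ τ σ)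

-- Makes richness decidable, so that `descent` can split on it constructively.
anySublist? : {P : List A → Set} → Decidable P → ∀ xs → Dec (∃[ ys ] (ys ⊆ xs × P ys))
anySublist? P? [] = map′ (λ p → [] , [] , p) (λ { ([] , [] , p) → p }) (P? [])
anySublist? P? (x ∷ xs) = map′
  (λ { (inj₁ (ys , τ , p)) → ys , x ∷ʳ τ , p
     ; (inj₂ (ys , τ , p)) → x ∷ ys , refl ∷ τ , p })
  (λ { (ys , _ ∷ʳ τ , p) → inj₁ (ys , τ , p)
     ; (_ ∷ ys , refl ∷ τ , p) → inj₂ (ys , τ , p) })
  (anySublist? P? xs ⊎-dec anySublist? (P? ∘ (x ∷_)) xs)

-- Double counting of related pairs: every column is filled to a fraction `1 / q`, hence so is the
-- average row.
popular-row : ∀ (xs : List A) (ys : List B) {R : A → B → Set} (R? : ∀ x y → Dec (R x y)) q →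
  0 < length xs → (∀ {y} → y ∈ ys → length xs ≤ q * ∑ xs (λ x → 𝟙 (R? x y))) →
  ∃[ x ] (x ∈ xs × length ys ≤ q * ∑ ys (λ y → 𝟙 (R? x y)))
popular-row xs ys R? q 0<xs h = large-summand xs _ (length ys) 0<xs (begin
  length xs * length ys                          ≡⟨ *-comm (length xs) _ ⟩
  length ys * length xs                          ≡⟨ ∑-const ys _ ⟨
  ∑ ys (const (length xs))                       ≤⟨ ∑-mono ys h ⟩
  ∑ ys (λ y → q * ∑ xs (λ x → 𝟙 (R? x y)))       ≡⟨ ∑-* ys q _ ⟩
  q * ∑ ys (λ y → ∑ xs (λ x → 𝟙 (R? x y)))       ≡⟨ cong (q *_) (∑-swap xs ys _) ⟨
  q * ∑ xs (λ x → ∑ ys (λ y → 𝟙 (R? x y)))       ≡⟨ ∑-* xs q _ ⟨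
  ∑ xs (λ x → q * ∑ ys (λ y → 𝟙 (R? x y)))       ∎)
  where open ≤-Reasoning

-- Lists of elements of Fin n

module _ {n : ℕ} where

  open DecMembership (Fin._≟_ {n}) public using (_∈?_)

  ∑-≟-unique : ∀ {xs : List (Fin n)} → Unique xs → ∀ y → ∑ xs (λ x → 𝟙 (x Fin.≟ y)) ≤ 1
  ∑-≟-unique []                    y = z≤n
  ∑-≟-unique (_∷_ {x} {xs} x∉ u) y with x Fin.≟ y
  ... | no _     = ∑-≟-unique u y
  ... | yes refl = s≤s (≤-trans
    (∑-mono xs {g = const 0} λ {z} z∈ → 𝟙-bound (z Fin.≟ x) λ z≡x →
      contradiction (sym z≡x) (All.lookup x∉ z∈))
    (≤-reflexive (trans (∑-const xs 0) (*-zeroʳ (length xs)))))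

  ∑-∈-unique : ∀ {xs : List (Fin n)} → Unique xs → ∀ ys → ∑ xs (λ x → 𝟙 (x ∈? ys)) ≤ length ys
  ∑-∈-unique {xs} u ys = begin
    ∑ xs (λ x → 𝟙 (x ∈? ys))                    ≤⟨ ∑-mono xs (λ {x} _ → 𝟙-bound (x ∈? ys) λ x∈ →
                                                     ≤-trans (𝟙-yes (x Fin.≟ x) refl)
                                                             (summand≤∑ (λ y → 𝟙 (x Fin.≟ y)) x∈)) ⟩
    ∑ xs (λ x → ∑ ys (λ y → 𝟙 (x Fin.≟ y)))     ≡⟨ ∑-swap xs ys _ ⟩
    ∑ ys (λ y → ∑ xs (λ x → 𝟙 (x Fin.≟ y)))     ≤⟨ ∑-mono ys (λ {y} _ → ∑-≟-unique u y) ⟩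
    ∑ ys (const 1)                              ≡⟨ ∑-one ys ⟩
    length ys                                   ∎
    where open ≤-Reasoning

  -- Otherwise sending each `i` to a position where it occurs would inject `Fin n` into the
  -- positions of `xs`.
  fresh : ∀ (xs : List (Fin n)) → length xs < n → ∃[ i ] i ∉ xs
  fresh xs <n = Fin.¬∀⟶∃¬ n (_∈ xs) (_∈? xs) λ all →
    <⇒≱ <n (Fin.injective⇒≤ {f = λ i → index (all i)} λ {i} {j} eq →
      trans (lookup-index (all i)) (trans (cong (List.lookup xs) eq) (sym (lookup-index (all j)))))

-- Sparse edge lists

-- An edge list is read as an undirected graph, (a , b) also standing for (b , a).
module EdgeList {n : ℕ} where

  V : Set
  V = Fin n

  SameEdge : V × V → V → V → Set
  SameEdge (a , b) u v = (u ≡ a × v ≡ b) ⊎ (u ≡ b × v ≡ a)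

  SameEdge-sym : ∀ e {u v} → SameEdge e u v → SameEdge e v u
  SameEdge-sym e (inj₁ (p , q)) = inj₂ (q , p)
  SameEdge-sym e (inj₂ (p , q)) = inj₁ (q , p)

  -- Opaque, so that H and u can be inferred from nb H u.
  opaque
    link : V → V → V → List V
    link a b u = if does (u Fin.≟ a) then b ∷ [] else []

    nb : List (V × V) → V → List V
    nb []            u = []
    nb ((a , b) ∷ H) u = link a b u ++ link b a u ++ nb H u

    nb-[] : ∀ u → nb [] u ≡ []
    nb-[] u = refl

    ∉-nb-[] : ∀ {u v} → v ∉ nb [] u
    ∉-nb-[] ()

    ∈-link⁺ : ∀ a b → b ∈ link a b a
    ∈-link⁺ a b with a Fin.≟ a
    ... | yes _  = here refl
    ... | no a≢a = contradiction refl a≢a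

    ∈-link⁻ : ∀ a b {u v} → v ∈ link a b u → u ≡ a × v ≡ b
    ∈-link⁻ a b {u} v∈ with u Fin.≟ a | v∈
    ... | yes u≡a | here v≡b = u≡a , v≡b

    ∈-nb-∷⁻ : ∀ e {H u v} → v ∈ nb (e ∷ H) u → SameEdge e u v ⊎ v ∈ nb H u
    ∈-nb-∷⁻ (a , b) {u = u} v∈ with ∈-++⁻ (link a b u) v∈
    ... | inj₁ v∈ = inj₁ (inj₁ (∈-link⁻ a b v∈))
    ... | inj₂ v∈ with ∈-++⁻ (link b a u) v∈
    ... | inj₁ v∈ = inj₁ (inj₂ (∈-link⁻ b a v∈))
    ... | inj₂ v∈ = inj₂ v∈

    ∈-nb-∷⁺ : ∀ e {H u v} → SameEdge e u v ⊎ v ∈ nb H u → v ∈ nb (e ∷ H) u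
    ∈-nb-∷⁺ (a , b)     (inj₁ (inj₁ (refl , refl))) = ∈-++⁺ˡ (∈-link⁺ a b)
    ∈-nb-∷⁺ (a , b)     (inj₁ (inj₂ (refl , refl))) = ∈-++⁺ʳ (link a b b) (∈-++⁺ˡ (∈-link⁺ b a))
    ∈-nb-∷⁺ (a , b) {u = u} (inj₂ v∈)               = ∈-++⁺ʳ (link a b u) (∈-++⁺ʳ (link b a u) v∈)

    length-link : ∀ a b u → length (link a b u) ≡ 𝟙 (u Fin.≟ a)
    length-link a b u with u Fin.≟ a
    ... | yes _ = refl
    ... | no  _ = refl

    length-nb-∷ : ∀ a b H u →
      length (nb ((a , b) ∷ H) u) ≡ 𝟙 (u Fin.≟ a) + (𝟙 (u Fin.≟ b) + length (nb H u))
    length-nb-∷ a b H u = trans (length-++ (link a b u))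
      (cong₂ _+_ (length-link a b u)
        (trans (length-++ (link b a u)) (cong (_+ length (nb H u)) (length-link b a u))))

  ball₂ ball₃ : List (V × V) → V → List V
  ball₂ H u = concatMap (nb H) (nb H u)
  ball₃ H u = concatMap (nb H) (ball₂ H u)

  -- Ends of walks of length two or three: a new edge from `u` to a vertex outside this list closes
  -- no triangle and no 4-cycle.
  near : List (V × V) → V → List V
  near H u = ball₂ H u ++ ball₃ H u

  nb-sym : ∀ H {u v} → v ∈ nb H u → u ∈ nb H v
  nb-sym []      v∈ = contradiction v∈ ∉-nb-[]
  nb-sym (e ∷ H) v∈ with ∈-nb-∷⁻ e v∈
  ... | inj₁ s  = ∈-nb-∷⁺ e (inj₁ (SameEdge-sym e s))
  ... | inj₂ v∈ = ∈-nb-∷⁺ e (inj₂ (nb-sym H v∈))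

  ∈⇒nb : ∀ {H u v} → (u , v) ∈ H → v ∈ nb H u
  ∈⇒nb {e ∷ H} (here refl) = ∈-nb-∷⁺ _ {H} (inj₁ (inj₁ (refl , refl)))
  ∈⇒nb {e ∷ H} (there uv∈) = ∈-nb-∷⁺ e (inj₂ (∈⇒nb uv∈))

  nb⇒∈ : ∀ H {u v} → v ∈ nb H u → (u , v) ∈ H ⊎ (v , u) ∈ H
  nb⇒∈ []            v∈ = contradiction v∈ ∉-nb-[]
  nb⇒∈ ((a , b) ∷ H) v∈ with ∈-nb-∷⁻ (a , b) v∈
  ... | inj₁ (inj₁ (refl , refl)) = inj₁ (here refl)
  ... | inj₁ (inj₂ (refl , refl)) = inj₂ (here refl)
  ... | inj₂ v∈ with nb⇒∈ H v∈
  ...   | inj₁ uv∈ = inj₁ (there uv∈)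
  ...   | inj₂ vu∈ = inj₂ (there vu∈)

  ∈-ball₂ : ∀ {H u v w} → v ∈ nb H u → w ∈ nb H v → w ∈ ball₂ H u
  ∈-ball₂ {H} v∈ w∈ = ∈-concatMap⁺ (nb H) (Any.map (λ { refl → w∈ }) v∈)

  ∈-ball₃ : ∀ {H u v w x} → v ∈ nb H u → w ∈ nb H v → x ∈ nb H w → x ∈ ball₃ H u
  ∈-ball₃ {H} v∈ w∈ x∈ = ∈-concatMap⁺ (nb H) (Any.map (λ { refl → x∈ }) (∈-ball₂ v∈ w∈))

  -- An edge contributes at most one at each of its two ends, since `U` has no repetitions. Ends may
  -- lie outside `U`, hence only an inequality.
  handshake : ∀ {U} → Unique U → ∀ H → ∑ U (λ u → length (nb H u)) ≤ 2 * length H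
  handshake {U} uniq [] = ≤-trans (∑-mono U λ {u} _ → ≤-reflexive (cong length (nb-[] u)))
    (≤-reflexive (trans (∑-const U 0) (*-zeroʳ (length U))))
  handshake {U} uniq ((a , b) ∷ H) = begin
    ∑ U (λ u → length (nb ((a , b) ∷ H) u))
      ≤⟨ ∑-mono U (λ {u} _ → ≤-reflexive (length-nb-∷ a b H u)) ⟩
    ∑ U (λ u → 𝟙 (u Fin.≟ a) + (𝟙 (u Fin.≟ b) + length (nb H u)))
      ≡⟨ ∑-+ U _ _ ⟩
    ∑ U (λ u → 𝟙 (u Fin.≟ a)) + ∑ U (λ u → 𝟙 (u Fin.≟ b) + length (nb H u))
      ≡⟨ cong (∑ U (λ u → 𝟙 (u Fin.≟ a)) +_) (∑-+ U _ _) ⟩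
    ∑ U (λ u → 𝟙 (u Fin.≟ a)) + (∑ U (λ u → 𝟙 (u Fin.≟ b)) + ∑ U (λ u → length (nb H u)))
      ≤⟨ +-mono-≤ (∑-≟-unique uniq a) (+-mono-≤ (∑-≟-unique uniq b) (handshake uniq H)) ⟩
    2 + 2 * length H
      ≡⟨ *-suc 2 (length H) ⟨
    2 * suc (length H) ∎
    where open ≤-Reasoning

  length-concatMap : ∀ (f : V → List V) {D} → (∀ v → length (f v) ≤ D) →
                     ∀ xs → length (concatMap f xs) ≤ length xs * D
  length-concatMap f h []       = z≤n
  length-concatMap f h (x ∷ xs) = ≤-trans (≤-reflexive (length-++ (f x)))
                                          (+-mono-≤ (h x) (length-concatMap f h xs))

  module _ (D : ℕ) where

    -- Unsaturated ends keep all degrees at most `D`, which in turn bounds the size of `near`.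
    record Allowed (H : List (V × V)) (a b : V) : Set where
      constructor allowed
      field
        a-unsaturated : length (nb H a) < D
        b-unsaturated : length (nb H b) < D
        not-near      : b ∉ near H a

    allowed? : ∀ H a b → Dec (Allowed H a b)
    allowed? H a b = map′ (λ (p , q , r) → allowed p q r) (λ (allowed p q r) → p , q , r)
      (length (nb H a) <? D ×-dec length (nb H b) <? D ×-dec ¬? (b ∈? near H a))

    -- The list keeps the order of insertion: each edge is tested only against the earlier ones.
    -- This suffices, as a short cycle would already violate the test of its newest edge.
    data Sparse : List (V × V) → Set where
      []  : Sparse []
      add : ∀ {a b H} → a ≢ b → Allowed H a b → Sparse H → Sparse ((a , b) ∷ H)

  open Allowed public

  module _ {D : ℕ} where

    length-nb≤ : ∀ {H} → Sparse D H → ∀ u → length (nb H u) ≤ D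
    length-nb≤ [] u rewrite nb-[] u = z≤n
    length-nb≤ (add {a} {b} {H} a≢b ok sp) u rewrite length-nb-∷ a b H u with u Fin.≟ a | u Fin.≟ b
    -- A loop would raise the degree by two and could overshoot `D`.
    ... | yes refl | yes refl = contradiction refl a≢b
    ... | yes refl | no _     = a-unsaturated ok
    ... | no _     | yes refl = b-unsaturated ok
    ... | no _     | no _     = length-nb≤ sp u

    length-near : ∀ {H} → Sparse D H → ∀ u → length (near H u) ≤ D * D + D * D * D
    length-near {H} sp u = begin
      length (near H u)                          ≡⟨ length-++ (ball₂ H u) ⟩
      length (ball₂ H u) + length (ball₃ H u)    ≤⟨ +-mono-≤ two
          (≤-trans (length-concatMap (nb H) (length-nb≤ sp) (ball₂ H u)) (*-monoˡ-≤ D two)) ⟩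
      D * D + D * D * D                          ∎
      where
      open ≤-Reasoning
      two : length (ball₂ H u) ≤ D * D
      two = ≤-trans (length-concatMap (nb H) (length-nb≤ sp) (nb H u)) (*-monoˡ-≤ D (length-nb≤ sp u))

    -- `not-near` looks from `a` only, so the walk from `y` back to `x` is reversed when `x` is `a`
    -- and taken as it stands when `y` is `a`.
    no-path₂ : ∀ {H a b x y z} → Allowed D H a b → SameEdge (a , b) x y →
               z ∈ nb H y → x ∈ nb H z → ⊥
    no-path₂ {H} {a} ok (inj₁ (refl , refl)) yz zx =
      not-near ok (∈-++⁺ˡ (∈-ball₂ (nb-sym H zx) (nb-sym H yz)))
    no-path₂ {H} {a} ok (inj₂ (refl , refl)) yz zx =
      not-near ok (∈-++⁺ˡ (∈-ball₂ yz zx))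

    no-path₃ : ∀ {H a b x y z w} → Allowed D H a b → SameEdge (a , b) x y →
               z ∈ nb H y → w ∈ nb H z → x ∈ nb H w → ⊥
    no-path₃ {H} {a} ok (inj₁ (refl , refl)) yz zw wx =
      not-near ok (∈-++⁺ʳ (ball₂ H a) (∈-ball₃ (nb-sym H wx) (nb-sym H zw) (nb-sym H yz)))
    no-path₃ {H} {a} ok (inj₂ (refl , refl)) yz zw wx =
      not-near ok (∈-++⁺ʳ (ball₂ H a) (∈-ball₃ yz zw wx))

    -- Moves the other edges of a cycle through `e` back into `H`: each of them has an end off `e`.
    old-edge : ∀ e {H x y z w} → SameEdge e x y → z ≢ x → z ≢ y → w ∈ nb (e ∷ H) z → w ∈ nb H z
    old-edge e s z≢x z≢y zw with ∈-nb-∷⁻ e zw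
    ... | inj₂ zw = zw
    ... | inj₁ s′ = ⊥-elim (distinct s s′)
      where
      distinct : SameEdge e _ _ → SameEdge e _ _ → ⊥
      distinct (inj₁ (x≡a , _)) (inj₁ (z≡a , _)) = z≢x (trans z≡a (sym x≡a))
      distinct (inj₁ (_ , y≡b)) (inj₂ (z≡b , _)) = z≢y (trans z≡b (sym y≡b))
      distinct (inj₂ (_ , y≡a)) (inj₁ (z≡a , _)) = z≢y (trans z≡a (sym y≡a))
      distinct (inj₂ (x≡b , _)) (inj₂ (z≡b , _)) = z≢x (trans z≡b (sym x≡b))

    old-edge′ : ∀ e {H x y z w} → SameEdge e x y → z ≢ x → z ≢ y → z ∈ nb (e ∷ H) w → z ∈ nb H w
    old-edge′ e {H} s z≢x z≢y wz = nb-sym H (old-edge e s z≢x z≢y (nb-sym (e ∷ H) wz))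

    no-new-C₃ : ∀ {H a b x y z} → Allowed D H a b → SameEdge (a , b) x y → z ≢ x → z ≢ y →
                z ∈ nb ((a , b) ∷ H) y → x ∈ nb ((a , b) ∷ H) z → ⊥
    no-new-C₃ ok s z≢x z≢y yz zx =
      no-path₂ ok s (old-edge′ _ s z≢x z≢y yz) (old-edge _ s z≢x z≢y zx)

    no-new-C₄ : ∀ {H a b x y z w} → Allowed D H a b → SameEdge (a , b) x y →
                z ≢ x → z ≢ y → w ≢ x → w ≢ y →
                z ∈ nb ((a , b) ∷ H) y → w ∈ nb ((a , b) ∷ H) z → x ∈ nb ((a , b) ∷ H) w → ⊥
    no-new-C₄ ok s z≢x z≢y w≢x w≢y yz zw wx =
      no-path₃ ok s (old-edge′ _ s z≢x z≢y yz) (old-edge _ s z≢x z≢y zw) (old-edge _ s w≢x w≢y wx)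

    -- Induction on the insertions: if the newest edge lies on the triangle, rotate it into first
    -- place and apply `no-new-C₃`; otherwise the triangle is older.
    no-C₃ : ∀ {H} → Sparse D H → ∀ {x y z} → x ≢ y → y ≢ z → z ≢ x →
            y ∈ nb H x → z ∈ nb H y → x ∈ nb H z → ⊥
    no-C₃ [] _ _ _ xy _ _ = ∉-nb-[] xy
    no-C₃ (add {a} {b} _ ok sp) x≢y y≢z z≢x xy yz zx
      with ∈-nb-∷⁻ (a , b) xy | ∈-nb-∷⁻ (a , b) yz | ∈-nb-∷⁻ (a , b) zx
    ... | inj₁ s   | _        | _        = no-new-C₃ ok s z≢x (≢-sym y≢z) yz zx
    ... | inj₂ _   | inj₁ s   | _        = no-new-C₃ ok s x≢y (≢-sym z≢x) zx xy
    ... | inj₂ _   | inj₂ _   | inj₁ s   = no-new-C₃ ok s y≢z (≢-sym x≢y) xy yz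
    ... | inj₂ xy′ | inj₂ yz′ | inj₂ zx′ = no-C₃ sp x≢y y≢z z≢x xy′ yz′ zx′

    -- As for triangles; the inequalities of opposite vertices keep the two remaining vertices off
    -- the newest edge.
    no-C₄ : ∀ {H} → Sparse D H → ∀ {x y z w} → x ≢ y → y ≢ z → z ≢ w → w ≢ x → x ≢ z → y ≢ w →
            y ∈ nb H x → z ∈ nb H y → w ∈ nb H z → x ∈ nb H w → ⊥
    no-C₄ [] _ _ _ _ _ _ xy _ _ _ = ∉-nb-[] xy
    no-C₄ (add {a} {b} _ ok sp) x≢y y≢z z≢w w≢x x≢z y≢w xy yz zw wx
      with ∈-nb-∷⁻ (a , b) xy | ∈-nb-∷⁻ (a , b) yz | ∈-nb-∷⁻ (a , b) zw | ∈-nb-∷⁻ (a , b) wx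
    ... | inj₁ s   | _        | _        | _        =
      no-new-C₄ ok s (≢-sym x≢z) (≢-sym y≢z) w≢x (≢-sym y≢w) yz zw wx
    ... | inj₂ _   | inj₁ s   | _        | _        =
      no-new-C₄ ok s (≢-sym y≢w) (≢-sym z≢w) x≢y x≢z zw wx xy
    ... | inj₂ _   | inj₂ _   | inj₁ s   | _        =
      no-new-C₄ ok s x≢z (≢-sym w≢x) y≢z y≢w wx xy yz
    ... | inj₂ _   | inj₂ _   | inj₂ _   | inj₁ s   =
      no-new-C₄ ok s y≢w (≢-sym x≢y) z≢w (≢-sym x≢z) xy yz zw
    ... | inj₂ xy′ | inj₂ yz′ | inj₂ zw′ | inj₂ wx′ =
      no-C₄ sp x≢y y≢z z≢w w≢x x≢z y≢w xy′ yz′ zw′ wx′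

open EdgeList

-- Chromatic number and girth

χ-colorable : ∀ G → Colorable G (χ G)
χ-colorable G = proj₁ (proj₂ (least (colorable? G) (order G , order-colorable G)))

χ-least : ∀ G {k} → Colorable G k → χ G ≤ k
χ-least G = proj₂ (proj₂ (least (colorable? G) (order G , order-colorable G)))

Colorable-mono : ∀ G {k l} → k ≤ l → Colorable G k → Colorable G l
Colorable-mono G k≤l (c , proper) = (λ v → Fin.inject≤ (c v) k≤l) , λ u v uv eq →
  proper u v uv (Fin.inject≤-injective k≤l k≤l _ _ eq)

¬Colorable⇒<χ : ∀ G {k} → ¬ Colorable G k → k < χ G
¬Colorable⇒<χ G ¬col = ≰⇒> λ χ≤k → ¬col (Colorable-mono G χ≤k (χ-colorable G))

girth≥5 : ∀ G → ¬ HasCycle G 3 → ¬ HasCycle G 4 → [ 5 ] ≤∞ girth G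
girth≥5 G ¬C₃ ¬C₄ with anyCycle? G
... | no  _   = _ ≤⊤⁺
... | yes cyc = [ long (proj₁ (proj₂ (least (hasCycle? G) cyc))) ]
  where
  long : ∀ {k} → HasCycle G k → 5 ≤ k
  long {0} (() , _)
  long {1} (s≤s () , _)
  long {2} (s≤s (s≤s ()) , _)
  long {3} h = contradiction h ¬C₃
  long {4} h = contradiction h ¬C₄
  long {suc (suc (suc (suc (suc k))))} _ = s≤s (s≤s (s≤s (s≤s (s≤s z≤n))))

girth≥5⇒C₄-Free : ∀ G → [ 5 ] ≤∞ girth G → C₄-Free G
girth≥5⇒C₄-Free G 5≤ h with anyCycle? G
girth≥5⇒C₄-Free G 5≤     h | no ¬cyc = ¬cyc (4 , h)
girth≥5⇒C₄-Free G [ 5≤ ] h | yes cyc = <⇒≱ 5≤ (proj₂ (proj₂ (least (hasCycle? G) cyc)) h)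

⊆ᴳ-trans : ∀ {G₁ G₂ G₃} → G₁ ⊆ᴳ G₂ → G₂ ⊆ᴳ G₃ → G₁ ⊆ᴳ G₃
⊆ᴳ-trans (f , f-inj , f-adj) (g , g-inj , g-adj) = g ∘ f , f-inj ∘ g-inj , g-adj ∘ f-adj

C₄-Free-⊆ᴳ : ∀ {H G} → H ⊆ᴳ G → C₄-Free G → C₄-Free H
C₄-Free-⊆ᴳ (f , f-inj , f-adj) free (3≤4 , c , c-inj , c-adj) =
  free (3≤4 , f ∘ c , (λ i j eq → c-inj i j (f-inj eq)) , λ i j nx → f-adj (c-adj i j nx))

-- The subgraph spanned by the first four classes of an optimal colouring.
exactly-4-chromatic : ∀ G → 4 ≤ χ G → ∃[ H ] (H ⊆ᴳ G × χ H ≡ 4)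
exactly-4-chromatic G 4≤χ = H , (id , (λ eq → eq) , proj₁) , ≤-antisym (χ-least H four) (¬Colorable⇒<χ H not-three)
  where
  c : Vertex G → Fin (χ G)
  c = proj₁ (χ-colorable G)
  c-proper : IsColoring G (χ G) c
  c-proper = proj₂ (χ-colorable G)

  H : Graph
  H = record
    { order      = order G
    ; Adj        = λ u v → Adj G u v × toℕ (c u) < 4 × toℕ (c v) < 4
    ; adj?       = λ u v → adj? G u v ×-dec (toℕ (c u) <? 4) ×-dec (toℕ (c v) <? 4)
    ; adj-sym    = λ (uv , u< , v<) → Graph.adj-sym G uv , v< , u<
    ; adj-irrefl = λ eq (uv , _) → Graph.adj-irrefl G eq uv
    }

  four : Colorable H 4
  -- Truncating larger colours to 3 is harmless, since vertices outside the first four classes are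
  -- isolated in `H`.
  four = (λ v → Fin.fromℕ< (s≤s (m⊓n≤n (toℕ (c v)) 3))) , λ u v (uv , u<4 , v<4) eq →
    c-proper u v uv (Fin.toℕ-injective (begin
      toℕ (c u)       ≡⟨ m≤n⇒m⊓n≡m (s≤s⁻¹ u<4) ⟨
      toℕ (c u) ⊓ 3   ≡⟨ Fin.toℕ-fromℕ< _ ⟨
      _               ≡⟨ cong toℕ eq ⟩
      _               ≡⟨ Fin.toℕ-fromℕ< _ ⟩
      toℕ (c v) ⊓ 3   ≡⟨ m≤n⇒m⊓n≡m (s≤s⁻¹ v<4) ⟩
      toℕ (c v)       ∎))
    where open ≡-Reasoning

  -- Three colours for the first four classes, with every later class shifted down by one, would
  -- colour `G` with `pred (χ G)` colours. Recoloured vertices stay below 3 and shifted ones do not.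
  not-three : ¬ Colorable H 3
  not-three (d , d-proper) = <⇒≱ (≤-reflexive suc-pred-χ) (χ-least G (c′ , c′-proper))
    where
    suc-pred-χ : suc (pred (χ G)) ≡ χ G
    suc-pred-χ = suc-pred (χ G) {{>-nonZero (≤-trans (s≤s z≤n) 4≤χ)}}

    3≤pred : 3 ≤ pred (χ G)
    3≤pred = pred-mono-≤ 4≤χ

    shift : ∀ v → 4 ≤ toℕ (c v) → pred (toℕ (c v)) < pred (χ G)
    shift v 4≤ = pred-mono-< {{>-nonZero (≤-trans (s≤s z≤n) 4≤)}} (Fin.toℕ<n (c v))

    new : ∀ v → Dec (toℕ (c v) < 4) → ℕ
    new v (yes _) = toℕ (d v)
    new v (no _)  = pred (toℕ (c v))

    new< : ∀ v p? → new v p? < pred (χ G)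
    new< v (yes _)  = <-≤-trans (Fin.toℕ<n (d v)) 3≤pred
    new< v (no v≮4) = shift v (≮⇒≥ v≮4)

    new-proper : ∀ u v p? q? → Adj G u v → new u p? ≢ new v q?
    new-proper u v (yes u<) (yes v<) uv eq = d-proper u v (uv , u< , v<) (Fin.toℕ-injective eq)
    new-proper u v (no u≮)  (no v≮)  uv eq = c-proper u v uv (Fin.toℕ-injective
      (pred-injective {{>-nonZero (≤-trans (s≤s z≤n) (≮⇒≥ u≮))}} {{>-nonZero (≤-trans (s≤s z≤n) (≮⇒≥ v≮))}} eq))
    new-proper u v (yes u<) (no v≮)  uv eq =
      <⇒≱ (Fin.toℕ<n (d u)) (≤-trans (pred-mono-≤ (≮⇒≥ v≮)) (≤-reflexive (sym eq)))
    new-proper u v (no u≮)  (yes v<) uv eq =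
      <⇒≱ (Fin.toℕ<n (d v)) (≤-trans (pred-mono-≤ (≮⇒≥ u≮)) (≤-reflexive eq))

    c′ : Vertex G → Fin (pred (χ G))
    c′ v = Fin.fromℕ< (new< v (toℕ (c v) <? 4))

    c′-proper : IsColoring G (pred (χ G)) c′
    c′-proper u v uv eq = new-proper u v (toℕ (c u) <? 4) (toℕ (c v) <? 4) uv
      (trans (sym (Fin.toℕ-fromℕ< _)) (trans (cong toℕ eq) (Fin.toℕ-fromℕ< _)))

-- Colourings of induced subgraphs

-- Colour zero collects the exceptional vertices: those of large degree in `¬Col-core`, the
-- saturated ones in `many-killers`.
setAside : ∀ {r} → Dec P → Fin r → Fin (suc r)
setAside (yes _) i = zero
setAside (no _)  i = suc i

setAside-zero : ∀ {r} {i : Fin r} (p? : Dec P) → setAside p? i ≡ zero → P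
setAside-zero (yes p) _ = p

setAside-suc : ∀ {r} {i j : Fin r} (p? : Dec P) → setAside p? i ≡ suc j → ¬ P × i ≡ j
setAside-suc (no ¬p) refl = ¬p , refl

-- The subgraph induced by W, the other vertices being kept as isolated ones.
_∣_ : (G : Graph) → List (Vertex G) → Graph
G ∣ W = record
  { order      = order G
  ; Adj        = λ u v → Adj G u v × u ∈ W × v ∈ W
  ; adj?       = λ u v → adj? G u v ×-dec (u ∈? W) ×-dec (v ∈? W)
  ; adj-sym    = λ (uv , u∈ , v∈) → Graph.adj-sym G uv , v∈ , u∈
  ; adj-irrefl = λ eq (uv , _) → Graph.adj-irrefl G eq uv
  }

module _ (G : Graph) where

  open Graph G using () renaming (Adj to _~_; adj-sym to ~-sym; adj-irrefl to ~-irrefl)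

  -- The filter is the one in `e`, so that the length for `U = allFin (order G)` is `e G` by
  -- definition.
  edges : List (Vertex G) → List (Vertex G × Vertex G)
  edges U = filter (λ (u , v) → (u Fin.<? v) ×-dec adj? G u v) (cartesianProduct U U)

  degree : List (Vertex G) → Vertex G → ℕ
  degree U v = length (filter (adj? G v) U)

  edges-⊆ : ∀ {W U} → W ⊆ U → edges W ⊆ edges U
  edges-⊆ τ = ⊆-filter⁺ _ _ (λ { refl p → p }) (cartesianProduct-⊆ τ τ)

  ∈-edges⁻ : ∀ {U u v} → (u , v) ∈ edges U → u ∈ U × v ∈ U × u Fin.< v × u ~ v
  ∈-edges⁻ {U} uv∈ =
    let uv∈ , u<v , uv = ∈-filter⁻ (λ (u , v) → (u Fin.<? v) ×-dec adj? G u v) {xs = cartesianProduct U U} uv∈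
        u∈ , v∈ = ∈-cartesianProduct⁻ U U uv∈
    in u∈ , v∈ , u<v , uv

  edges-pos : ∀ {U u v} → u ∈ U → v ∈ U → u ~ v → 0 < length (edges U)
  edges-pos {U} {u} {v} u∈ v∈ uv with Fin.<-cmp u v
  ... | tri< u<v _ _  = ∈-length (∈-filter⁺ _ (∈-cartesianProduct⁺ u∈ v∈) (u<v , uv))
  ... | tri≈ _ u≡v _  = contradiction uv (~-irrefl u≡v)
  ... | tri> _ _ v<u  = ∈-length (∈-filter⁺ _ (∈-cartesianProduct⁺ v∈ u∈) (v<u , ~-sym uv))

  -- Each adjacency is listed in exactly one of its two orientations, and swapping the sums shows
  -- that both orientations have the same count.
  ∑-degree : ∀ U → ∑ U (degree U) ≤ 2 * length (edges U)
  ∑-degree U = begin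
    ∑ U (degree U)
      ≤⟨ ∑-mono U (λ {u} _ → ≤-trans (≤-reflexive (length-filter (adj? G u) U))
                                     (∑-mono U λ {v} _ → oriented u v)) ⟩
    ∑ U (λ u → ∑ U (λ v → 𝟙 (Q? (u , v)) + 𝟙 (Q? (v , u))))
      ≤⟨ ∑-mono U (λ {u} _ → ≤-reflexive (∑-+ U (λ v → 𝟙 (Q? (u , v))) (λ v → 𝟙 (Q? (v , u))))) ⟩
    ∑ U (λ u → ∑ U (λ v → 𝟙 (Q? (u , v))) + ∑ U (λ v → 𝟙 (Q? (v , u))))
      ≡⟨ ∑-+ U _ _ ⟩
    ∑ U (λ u → ∑ U (λ v → 𝟙 (Q? (u , v)))) + ∑ U (λ u → ∑ U (λ v → 𝟙 (Q? (v , u))))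
      ≡⟨ cong₂ _+_ count (trans (∑-swap U U (λ u v → 𝟙 (Q? (v , u)))) count) ⟩
    length (edges U) + length (edges U)
      ≡⟨ cong (length (edges U) +_) (+-identityʳ _) ⟨
    2 * length (edges U) ∎
    where
    open ≤-Reasoning
    Q? : Decidable (λ ((u , v) : Vertex G × Vertex G) → u Fin.< v × u ~ v)
    Q? (u , v) = (u Fin.<? v) ×-dec adj? G u v

    count : ∑ U (λ u → ∑ U (λ v → 𝟙 (Q? (u , v)))) ≡ length (edges U)
    count = sym (trans (length-filter Q? (cartesianProduct U U)) (∑-× U U _))

    oriented : ∀ u v → 𝟙 (adj? G u v) ≤ 𝟙 (Q? (u , v)) + 𝟙 (Q? (v , u))
    oriented u v = 𝟙-bound (adj? G u v) λ uv → cases uv (Fin.<-cmp u v)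
      where
      cases : u ~ v → _ → 1 ≤ 𝟙 (Q? (u , v)) + 𝟙 (Q? (v , u))
      cases uv (tri< u<v _ _) = m≤n⇒m≤n+o _ (𝟙-yes (Q? (u , v)) (u<v , uv))
      cases uv (tri≈ _ u≡v _) = contradiction uv (~-irrefl u≡v)
      cases uv (tri> _ _ v<u) = m≤n⇒m≤o+n _ (𝟙-yes (Q? (v , u)) (v<u , ~-sym uv))

  Col : List (Vertex G) → ℕ → Set
  Col W = Colorable (G ∣ W)

  col? : ∀ W k → Dec (Col W k)
  col? W = colorable? (G ∣ W)

  Col-edgeless : ∀ W {k} → 0 < k → (∀ {u v} → u ∈ W → v ∈ W → ¬ (u ~ v)) → Col W k
  Col-edgeless W 0<k none = (λ _ → Fin.fromℕ< 0<k) , λ u v (uv , u∈ , v∈) _ → none u∈ v∈ uv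

  -- Product colouring: a vertex gets its class paired with its colour inside that class.
  Col-classes : ∀ U {a b} (c : Vertex G → Fin a) →
                (∀ i → Col (filter (λ v → c v Fin.≟ i) U) b) → Col U (a * b)
  Col-classes U c cols = (λ v → Fin.combine (c v) (proj₁ (cols (c v)) v)) , λ u v (uv , u∈ , v∈) eq →
    let cu≡cv , eq′ = Fin.combine-injective (c u) _ (c v) _ eq
        d , d-proper = cols (c v)
    in d-proper u v
         (uv , ∈-filter⁺ (λ w → c w Fin.≟ c v) u∈ cu≡cv , ∈-filter⁺ (λ w → c w Fin.≟ c v) v∈ refl)
         (trans (cong (λ i → proj₁ (cols i) u) (sym cu≡cv)) eq′)

  Col-greedy : ∀ U {k} → 0 < k → ∀ {W} → W ⊆ U → (∀ {v} → v ∈ W → degree U v < k) → Col W k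
  Col-greedy U 0<k {[]} τ small = Col-edgeless [] 0<k λ ()
  Col-greedy U {k} 0<k {w ∷ W} τ small
    with c , c-proper ← Col-greedy U 0<k {W} (∷ˡ⁻ τ) (small ∘ there)
    -- The new colour avoids those of all neighbours in `U`, whether or not they are coloured yet;
    -- there are fewer than `k` of them.
    with i , i∉ ← fresh (map c (filter (adj? G w) U)) (subst (_< k) (sym (length-map c (filter (adj? G w) U))) (small (here refl)))
    = updateAt c w (const i) , proper
    where
    new : Vertex G → Fin _
    new = updateAt c w (const i)

    new-≢ : ∀ v → v ~ w → v ∈ w ∷ W → new v ≢ new w
    new-≢ v vw v∈ eq = i∉ (subst (_∈ map c (filter (adj? G w) U)) cv≡i
        (∈-map⁺ c (∈-filter⁺ (adj? G w) (lookup τ v∈) (~-sym vw))))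
      where
      cv≡i : c v ≡ i
      cv≡i = trans (sym (updateAt-minimal v w c λ v≡w → ~-irrefl v≡w vw)) (trans eq (updateAt-updates w c))

    proper : IsColoring (G ∣ (w ∷ W)) _ new
    proper u v (uv , u∈ , v∈) with u Fin.≟ w | v Fin.≟ w | u∈ | v∈
    ... | yes refl | _        | _          | _          = λ eq → new-≢ v (~-sym uv) v∈ (sym eq)
    ... | no _     | yes refl | _          | _          = new-≢ u uv u∈
    ... | no u≢w   | no _     | here u≡w   | _          = contradiction u≡w u≢w
    ... | no _     | no v≢w   | there _    | here v≡w   = contradiction v≡w v≢w
    ... | no u≢w   | no v≢w   | there u∈W  | there v∈W  = λ eq → c-proper u v (uv , u∈W , v∈W)
      (trans (sym (updateAt-minimal u w c u≢w)) (trans eq (updateAt-minimal v w c v≢w)))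

  -- Unlike the usual `d`-core, low degrees are removed once only and may reappear.
  core : ℕ → List (Vertex G) → List (Vertex G)
  core d U = filter (λ v → d ≤? degree U v) U

  ∣core∣ : ∀ d U → d * length (core d U) ≤ 2 * length (edges U)
  ∣core∣ d U = ≤-trans (∑-filter (λ v → d ≤? degree U v) U (degree U) (λ _ d≤ → d≤)) (∑-degree U)

  -- Outside the core degrees in `U` are below `k`, so greedy colouring needs only `k` colours
  -- there; `k` more for the core would make `2 * k`.
  ¬Col-core : ∀ {d k} U → 0 < k → d ≤ k → ¬ Col U (2 * k) → ¬ Col (core d U) k
  ¬Col-core {d} {k} U 0<k d≤k ¬col col-core = ¬col (Col-classes U side classes)
    where
    side : Vertex G → Fin 2
    side v = setAside (d ≤? degree U v) zero

    classes : ∀ i → Col (filter (λ v → side v Fin.≟ i) U) k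
    classes zero = proj₁ col-core , λ u v (uv , u∈ , v∈) → proj₂ col-core u v (uv , sub u∈ , sub v∈)
      where
      sub : ∀ {v} → v ∈ filter (λ v → side v Fin.≟ zero) U → v ∈ core d U
      sub v∈ = let v∈U , eq = ∈-filter⁻ (λ v → side v Fin.≟ zero) {xs = U} v∈
               in ∈-filter⁺ (λ v → d ≤? degree U v) v∈U (setAside-zero (d ≤? _) eq)
    classes (suc zero) = Col-greedy U 0<k (filter-⊆ (λ v → side v Fin.≟ suc zero) U) λ v∈ →
      let _ , eq = ∈-filter⁻ (λ v → side v Fin.≟ suc zero) {xs = U} v∈
      in <-≤-trans (≰⇒> (proj₁ (setAside-suc (d ≤? _) eq))) d≤k

-- Enumerating colourings

module _ {n r : ℕ} (i₀ : Fin r) where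

  -- One representative for each choice of colours on the listed vertices, with `i₀` elsewhere.
  -- Completeness is agreement on `vs`, which is enough for edges inside `U` and avoids function
  -- extensionality.
  colorings : List (Fin n) → List (Fin n → Fin r)
  colorings []       = const i₀ ∷ []
  colorings (v ∷ vs) = cartesianProductWith (λ i c → updateAt c v (const i)) (allFin r) (colorings vs)

  length-colorings : ∀ vs → length (colorings vs) ≡ r ^ length vs
  length-colorings []       = refl
  length-colorings (v ∷ vs) = trans (length-prod (allFin r) (colorings vs))
    (cong₂ _*_ (length-tabulate {n = r} id) (length-colorings vs))
    where
    length-prod : ∀ {A B C : Set} {f : A → B → C} xs ys → length (cartesianProductWith f xs ys) ≡ length xs * length ys
    length-prod []       ys = refl
    length-prod {f = f} (x ∷ xs) ys =
      trans (length-++ (map (f x) ys)) (cong₂ _+_ (length-map (f x) ys) (length-prod xs ys))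

  colorings-complete : ∀ vs (c : Fin n → Fin r) → ∃[ c′ ] (c′ ∈ colorings vs × (∀ {v} → v ∈ vs → c′ v ≡ c v))
  colorings-complete []       c = const i₀ , here refl , λ ()
  colorings-complete (v ∷ vs) c with c′ , c′∈ , agree ← colorings-complete vs c =
    updateAt c′ v (const (c v)) , ∈-cartesianProductWith⁺ _ (∈-allFin (c v)) c′∈ , agree′
    where
    agree′ : ∀ {w} → w ∈ v ∷ vs → updateAt c′ v (const (c v)) w ≡ c w
    agree′ {w} w∈ with w Fin.≟ v | w∈
    ... | yes refl | _         = updateAt-updates v c′
    ... | no w≢v   | here w≡v  = contradiction w≡v w≢v
    ... | no w≢v   | there w∈  = trans (updateAt-minimal w v c′ w≢v) (agree w∈)

-- Arithmetic of the greedy process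

^-distribʳ-* : ∀ m n o → (m * n) ^ o ≡ m ^ o * n ^ o
^-distribʳ-* m n zero    = refl
^-distribʳ-* m n (suc o) rewrite ^-distribʳ-* m n o = shuffle m n (m ^ o) (n ^ o)
  where
  shuffle : ∀ a b c d → a * b * (c * d) ≡ a * c * (b * d)
  shuffle = solve-∀

-- `(1 + 1/x) ^ y ≥ 1 + y/x` with denominators cleared.
bernoulli : ∀ x y → x ^ y * (x + y) ≤ suc x ^ y * x
bernoulli x zero    = ≤-reflexive (cong (1 *_) (+-identityʳ x))
bernoulli x (suc y) = begin
  x * x ^ y * (x + suc y)         ≡⟨ assoc x (x ^ y) y ⟩
  x ^ y * (x * (x + suc y))       ≤⟨ *-monoʳ-≤ (x ^ y) (m+n≤o⇒m≤o _ (≤-reflexive (expand x y))) ⟩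
  x ^ y * ((x + y) * suc x)       ≡⟨ *-assoc (x ^ y) (x + y) (suc x) ⟨
  x ^ y * (x + y) * suc x         ≤⟨ *-monoˡ-≤ (suc x) (bernoulli x y) ⟩
  suc x ^ y * x * suc x           ≡⟨ rotate (suc x) (suc x ^ y) x ⟩
  suc x * suc x ^ y * x           ∎
  where
  open ≤-Reasoning
  assoc : ∀ x p y → x * p * (x + suc y) ≡ p * (x * (x + suc y))
  assoc = solve-∀
  expand : ∀ x y → x * (x + suc y) + y ≡ (x + y) * suc x
  expand = solve-∀
  rotate : ∀ a b x → b * x * a ≡ a * b * x
  rotate = solve-∀

-- Bernoulli's inequality at exponent `suc x`, where `1 + (x + 1)/x` is at least 2.
doubling : ∀ x → .{{NonZero x}} → 2 * x ^ suc x ≤ suc x ^ suc x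
doubling x = *-cancelʳ-≤ (2 * x ^ suc x) (suc x ^ suc x) x (begin
  2 * x ^ suc x * x               ≡⟨ rotate (x ^ suc x) x ⟩
  x ^ suc x * (x + x)             ≤⟨ *-monoʳ-≤ (x ^ suc x) (+-monoʳ-≤ x (n≤1+n x)) ⟩
  x ^ suc x * (x + suc x)         ≤⟨ bernoulli x (suc x) ⟩
  suc x ^ suc x * x               ∎)
  where
  open ≤-Reasoning
  rotate : ∀ p x → 2 * p * x ≡ p * (x + x)
  rotate = solve-∀

-- By `doubling`, every `suc x` steps gain a factor 2; `2 * n` such rounds gain `4 ^ n`, which beats
-- the `3 ^ n` colourings.
extinction : ∀ x n → .{{NonZero x}} → .{{NonZero n}} →
             3 ^ n * x ^ (suc x * (2 * n)) < suc x ^ (suc x * (2 * n))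
extinction x n = begin-strict
  3 ^ n * x ^ (suc x * (2 * n))           <⟨ *-monoˡ-< (x ^ (suc x * (2 * n))) {{m^n≢0 x (suc x * (2 * n))}} (^-monoˡ-< n (s≤s (s≤s (s≤s (s≤s z≤n))))) ⟩
  4 ^ n * x ^ (suc x * (2 * n))           ≡⟨ cong₂ _*_ (sym (^-*-assoc 2 2 n)) refl ⟨
  (2 ^ (2 * n)) * x ^ (suc x * (2 * n))   ≡⟨ cong (2 ^ (2 * n) *_) (^-*-assoc x (suc x) (2 * n)) ⟨
  2 ^ (2 * n) * (x ^ suc x) ^ (2 * n)     ≡⟨ ^-distribʳ-* 2 (x ^ suc x) (2 * n) ⟨
  (2 * x ^ suc x) ^ (2 * n)               ≤⟨ ^-monoˡ-≤ (2 * n) (doubling x) ⟩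
  (suc x ^ suc x) ^ (2 * n)               ≡⟨ ^-*-assoc (suc x) (suc x) (2 * n) ⟩
  suc x ^ (suc x * (2 * n))               ∎
  where open ≤-Reasoning

-- The invariant `length S * (1 - 1/q) ^ f < 1`, cleared of denominators, says that `f` more steps
-- leave nothing. It persists because a step removes at least a fraction `1 / q` of `S`.
survivors-decay : ∀ {A : Set} {P : Pred A 0ℓ} (P? : Decidable P) S q f → .{{NonZero q}} →
  length S ≤ q * ∑ S (𝟙 ∘ P?) → length S * pred q ^ suc f < q ^ suc f →
  length (filter (¬? ∘ P?) S) * pred q ^ f < q ^ f
survivors-decay P? S q f S≤ lt = *-cancelˡ-< q _ _ (begin-strict
  q * (s′ * x ^ f)        ≡⟨ *-assoc q s′ (x ^ f) ⟨
  q * s′ * x ^ f          ≤⟨ *-monoˡ-≤ (x ^ f) (+-cancelʳ-≤ s _ _ shrink) ⟩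
  x * s * x ^ f           ≡⟨ swap x s (x ^ f) ⟩
  s * (x * x ^ f)         <⟨ lt ⟩
  q * q ^ f               ∎)
  where
  open ≤-Reasoning
  x s s′ hit : ℕ
  x = pred q
  s = length S
  s′ = length (filter (¬? ∘ P?) S)
  hit = ∑ S (𝟙 ∘ P?)

  swap : ∀ a b c → a * b * c ≡ b * (a * c)
  swap = solve-∀

  exclusive : ∀ {Q : Set} (q? : Dec Q) → 𝟙 (¬? q?) + 𝟙 q? ≤ 1
  exclusive (yes _) = s≤s z≤n
  exclusive (no _)  = s≤s z≤n

  total : s′ + hit ≤ s
  total = begin
    s′ + hit                                ≡⟨ cong (_+ hit) (length-filter (¬? ∘ P?) S) ⟩
    ∑ S (𝟙 ∘ ¬? ∘ P?) + hit                 ≡⟨ ∑-+ S _ _ ⟨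
    ∑ S (λ c → 𝟙 (¬? (P? c)) + 𝟙 (P? c))    ≤⟨ ∑-mono S (λ {c} _ → exclusive (P? c)) ⟩
    ∑ S (const 1)                           ≡⟨ ∑-one S ⟩
    s                                       ∎

  shrink : q * s′ + s ≤ x * s + s
  shrink = begin
    q * s′ + s        ≤⟨ +-monoʳ-≤ (q * s′) S≤ ⟩
    q * s′ + q * hit  ≡⟨ *-distribˡ-+ q s′ hit ⟨
    q * (s′ + hit)    ≤⟨ *-monoʳ-≤ q total ⟩
    q * s             ≡⟨ cong (_* s) (suc-pred q) ⟨
    s + x * s         ≡⟨ +-comm s (x * s) ⟩
    x * s + s         ∎

-- The greedy process

-- `8K²≤D` keeps the saturated vertices few, and `K²D³≤k` lets edges near `H` be at most half of
-- those in a rich class. The factor 4 in `¬col` covers three colour classes and the saturated set.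
module Greedy (G : Graph) {U : List (Vertex G)} (uniq : Unique U) {K k D : ℕ} .{{_ : NonZero K}}
  (0<k : 0 < k)
  (8K²≤D : 8 * (K * K) ≤ D)
  (K²D³≤k : 4 * (K * K) * (D * D + D * D * D) ≤ k)
  (¬col : ¬ Col G U (4 * k))
  (rich : ∀ {W} → W ⊆ U → ¬ Col G W k →
          length U * length (edges G U) < K * (length W * length (edges G W)))
  where

  n m q x t : ℕ
  n = length U
  m = length (edges G U)
  q = 2 * K
  x = pred q
  t = q * (2 * n)

  -- Richness bounds a product from below; as `W` has at most `m` edges, the vertex factor alone
  -- must be large. `rich-edges` exchanges the two factors.
  rich-vertices : ∀ {W} → W ⊆ U → ¬ Col G W k → n < K * length W
  rich-vertices {W} τ ¬colW = ≰⇒> λ Kw≤n → <⇒≱ (rich τ ¬colW) (begin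
    K * (length W * length (edges G W))   ≡⟨ *-assoc K (length W) _ ⟨
    K * length W * length (edges G W)     ≤⟨ *-mono-≤ Kw≤n (length-mono-≤ (edges-⊆ G τ)) ⟩
    n * m                                 ∎)
    where open ≤-Reasoning

  rich-edges : ∀ {W} → W ⊆ U → ¬ Col G W k → m < K * length (edges G W)
  rich-edges {W} τ ¬colW = ≰⇒> λ Ke≤m → <⇒≱ (rich τ ¬colW) (begin
    K * (length W * length (edges G W))   ≡⟨ swap K (length W) _ ⟩
    length W * (K * length (edges G W))   ≤⟨ *-mono-≤ (length-mono-≤ τ) Ke≤m ⟩
    n * m                                 ∎)
    where
    open ≤-Reasoning
    swap : ∀ a b c → a * (b * c) ≡ b * (a * c)
    swap = solve-∀

  ¬col-U : ∀ {l} → l ≤ 4 → ¬ Col G U (l * k)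
  ¬col-U l≤4 = ¬col ∘ Colorable-mono (G ∣ U) (*-monoˡ-≤ k l≤4)

  nm-positive : 0 < n * m
  -- Richness of `U` itself reads `n * m < K * (n * m)`.
  nm-positive = positive (n * m) (rich ⊆-refl (¬col-U (s≤s z≤n) ∘ subst (Col G U) (sym (*-identityˡ k))))
    where
    positive : ∀ p → p < K * p → 0 < p
    positive zero    lt = contradiction (<-≤-trans lt (≤-reflexive (*-zeroʳ K))) λ ()
    positive (suc p) _  = s≤s z≤n

  instance
    n-nonZero : NonZero n
    n-nonZero = m*n≢0⇒m≢0 n {{>-nonZero nm-positive}}

    m-nonZero : NonZero m
    m-nonZero = m*n≢0⇒n≢0 n {{>-nonZero nm-positive}}

    q-nonZero : NonZero q
    q-nonZero = m*n≢0 2 K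

    x-nonZero : NonZero x
    x-nonZero = >-nonZero (pred-mono-≤ (*-monoʳ-≤ 2 (>-nonZero⁻¹ K)))

  -- The vertices of degree at least `k` are not `k`-colourable, so by richness they number more
  -- than `n / K`; their degrees sum to at most `2 * m`.
  average-degree : k * n ≤ q * m
  average-degree = begin
    k * n                               ≤⟨ *-monoʳ-≤ k (<⇒≤ (rich-vertices (filter-⊆ _ U)
                                             (¬Col-core G U 0<k ≤-refl (¬col-U (s≤s (s≤s z≤n)))))) ⟩
    k * (K * length (core G k U))       ≡⟨ swap k K _ ⟩
    K * (k * length (core G k U))       ≤⟨ *-monoʳ-≤ K (∣core∣ G k U) ⟩
    K * (2 * m)                         ≡⟨ swap′ K m ⟩
    q * m                               ∎
    where
    open ≤-Reasoning
    swap : ∀ a b c → a * (b * c) ≡ b * (a * c)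
    swap = solve-∀
    swap′ : ∀ a b → a * (2 * b) ≡ 2 * a * b
    swap′ = solve-∀

  near-bound : q * (n * (D * D + D * D * D)) ≤ m
  near-bound = *-cancelˡ-≤ q (begin
    q * (q * (n * (D * D + D * D * D)))         ≡⟨ regroup K n (D * D + D * D * D) ⟩
    4 * (K * K) * (D * D + D * D * D) * n       ≤⟨ *-monoˡ-≤ n K²D³≤k ⟩
    k * n                                       ≤⟨ average-degree ⟩
    q * m                                       ∎)
    where
    open ≤-Reasoning
    regroup : ∀ K n B → 2 * K * (2 * K * (n * B)) ≡ 4 * (K * K) * B * n
    regroup = solve-∀

  Kills : List (Vertex G × Vertex G) → Vertex G × Vertex G → (Vertex G → Fin 3) → Set
  Kills H (a , b) c = Allowed D H a b × c a ≡ c b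

  kills? : ∀ H e c → Dec (Kills H e c)
  kills? H (a , b) c = allowed? D H a b ×-dec c a Fin.≟ c b

  module _ {H : List (Vertex G × Vertex G)} (sp : Sparse D H) (∣H∣≤t : length H ≤ t) where

    count-near : ∑ (edges G U) (λ (u , v) → 𝟙 (v ∈? near H u)) ≤ n * (D * D + D * D * D)
    count-near = begin
      ∑ (edges G U) (λ (u , v) → 𝟙 (v ∈? near H u))
        ≤⟨ ∑-⊆ _ (filter-⊆ _ (cartesianProduct U U)) ⟩
      ∑ (cartesianProduct U U) (λ (u , v) → 𝟙 (v ∈? near H u))
        ≡⟨ ∑-× U U _ ⟩
      ∑ U (λ u → ∑ U (λ v → 𝟙 (v ∈? near H u)))
        ≤⟨ ∑-mono U (λ {u} _ → ≤-trans (∑-∈-unique uniq (near H u)) (length-near sp u)) ⟩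
      ∑ U (const (D * D + D * D * D))
        ≡⟨ ∑-const U _ ⟩
      n * (D * D + D * D * D) ∎
      where open ≤-Reasoning

    -- If not `k`-colourable, the set would have more than `n / K` vertices of degree at least
    -- `8 K²`, whose degree sum exceeds `8 K n`. But `H` has at most `t = 4 K n` edges.
    few-saturated : ∀ {P : Pred (Vertex G) 0ℓ} (P? : Decidable P) → (∀ {v} → P v → D ≤ length (nb H v)) →
                    Col G (filter P? U) k
    few-saturated P? sat = decidable-stable (col? G (filter P? U) k) λ ¬colS →
      <⇒≱ (rich-vertices (filter-⊆ P? U) ¬colS) (*-cancelˡ-≤ (8 * K) {{m*n≢0 8 K}} (begin
        8 * K * (K * length (filter P? U))    ≡⟨ regroup K _ ⟩
        8 * (K * K) * length (filter P? U)    ≤⟨ *-monoˡ-≤ _ 8K²≤D ⟩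
        D * length (filter P? U)              ≤⟨ ∑-filter P? U (λ v → length (nb H v)) (λ _ → sat) ⟩
        ∑ U (λ v → length (nb H v))           ≤⟨ handshake uniq H ⟩
        2 * length H                          ≤⟨ *-monoʳ-≤ 2 ∣H∣≤t ⟩
        2 * t                                 ≡⟨ regroup′ K n ⟩
        8 * K * n                             ∎))
      where
      open ≤-Reasoning
      regroup : ∀ K s → 8 * K * (K * s) ≡ 8 * (K * K) * s
      regroup = solve-∀
      regroup′ : ∀ K n → 2 * (2 * K * (2 * n)) ≡ 8 * K * n
      regroup′ = solve-∀

    many-killers : ∀ c → m ≤ q * ∑ (edges G U) (λ e → 𝟙 (kills? H e c))
    many-killers c = let i , ¬colᵢ = Fin.¬∀⟶∃¬ 4 _ (λ i → col? G (W i) k) (¬col ∘ Col-classes G U class)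
                     in bound i ¬colᵢ
      where
      class : Vertex G → Fin 4
      class v = setAside (D ≤? length (nb H v)) (c v)

      W : Fin 4 → List (Vertex G)
      W i = filter (λ v → class v Fin.≟ i) U

      bound : ∀ i → ¬ Col G (W i) k → m ≤ q * ∑ (edges G U) (λ e → 𝟙 (kills? H e c))
      bound zero ¬colᵢ =
        contradiction (few-saturated (λ v → class v Fin.≟ zero) (setAside-zero (D ≤? _))) ¬colᵢ
      -- By richness `q` times the edges of the class is at least `2 * m`; edges near `H` account
      -- for at most `m` of this, and the others kill `c`.
      bound (suc j) ¬colᵢ = +-cancelˡ-≤ m _ _ (begin
        m + m
          ≡⟨ cong (m +_) (+-identityʳ m) ⟨
        2 * m
          ≤⟨ *-monoʳ-≤ 2 (<⇒≤ (rich-edges (filter-⊆ _ U) ¬colᵢ)) ⟩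
        2 * (K * length (edges G (W (suc j))))
          ≡⟨ *-assoc 2 K _ ⟨
        q * length (edges G (W (suc j)))
          ≤⟨ *-monoʳ-≤ q each-edge ⟩
        q * (n * (D * D + D * D * D) + killers)
          ≡⟨ *-distribˡ-+ q _ killers ⟩
        q * (n * (D * D + D * D * D)) + q * killers
          ≤⟨ +-monoˡ-≤ (q * killers) near-bound ⟩
        m + q * killers ∎)
        where
        open ≤-Reasoning
        killers = ∑ (edges G U) (λ e → 𝟙 (kills? H e c))

        member : ∀ {v} → v ∈ W (suc j) → length (nb H v) < D × c v ≡ j
        member v∈ = let _ , eq = ∈-filter⁻ (λ v → class v Fin.≟ suc j) {xs = U} v∈
                        unsat , cv≡j = setAside-suc (D ≤? _) eq
                    in ≰⇒> unsat , cv≡j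

        near-or-kills : ∀ {u v} → (u , v) ∈ edges G (W (suc j)) →
                        1 ≤ 𝟙 (v ∈? near H u) + 𝟙 (kills? H (u , v) c)
        near-or-kills {u} {v} uv∈ with u∈ , v∈ , _ ← ∈-edges⁻ G {W (suc j)} uv∈ = cases (v ∈? near H u)
          where
          cases : (p? : Dec (v ∈ near H u)) → 1 ≤ 𝟙 p? + 𝟙 (kills? H (u , v) c)
          cases (yes _)  = s≤s z≤n
          cases (no far) = let u-unsat , cu≡j = member u∈
                               v-unsat , cv≡j = member v∈
                           in 𝟙-yes (kills? H (u , v) c) (allowed u-unsat v-unsat far , trans cu≡j (sym cv≡j))

        each-edge : length (edges G (W (suc j))) ≤ n * (D * D + D * D * D) + killers
        each-edge = begin
          length (edges G (W (suc j)))
            ≡⟨ ∑-one (edges G (W (suc j))) ⟨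
          ∑ (edges G (W (suc j))) (const 1)
            ≤⟨ ∑-mono (edges G (W (suc j))) near-or-kills ⟩
          ∑ (edges G (W (suc j))) (λ (u , v) → 𝟙 (v ∈? near H u) + 𝟙 (kills? H (u , v) c))
            ≤⟨ ∑-⊆ _ (edges-⊆ G (filter-⊆ _ U)) ⟩
          ∑ (edges G U) (λ (u , v) → 𝟙 (v ∈? near H u) + 𝟙 (kills? H (u , v) c))
            ≡⟨ ∑-+ (edges G U) _ _ ⟩
          ∑ (edges G U) (λ (u , v) → 𝟙 (v ∈? near H u)) + killers
            ≤⟨ +-monoˡ-≤ killers count-near ⟩
          n * (D * D + D * D * D) + killers ∎

    good-edge : ∀ S → 0 < length S →
      ∃[ a ] ∃[ b ] ((a , b) ∈ edges G U × Allowed D H a b ×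
                     length S ≤ q * ∑ S (λ c → 𝟙 (c a Fin.≟ c b)))
    good-edge S 0<S
      with (a , b) , ab∈ , S≤ ← popular-row (edges G U) S (kills? H) q (>-nonZero⁻¹ m) (λ {c} _ → many-killers c)
      with allowed? D H a b
    ... | yes ok = a , b , ab∈ , ok , ≤-trans S≤ (*-monoʳ-≤ q (∑-mono S λ {c} _ →
                     𝟙-bound (kills? H (a , b) c) λ (_ , ca≡cb) → 𝟙-yes (c a Fin.≟ c b) ca≡cb))
    -- A forbidden edge kills no colouring at all, whereas the popular one kills a fraction of the
    -- nonempty `S`.
    ... | no ¬ok = contradiction (begin-strict
        0                                           <⟨ 0<S ⟩
        length S                                    ≤⟨ S≤ ⟩
        q * ∑ S (λ c → 𝟙 (kills? H (a , b) c))      ≤⟨ *-monoʳ-≤ q (∑-mono S {g = const 0} λ {c} _ →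
                                                         𝟙-bound (kills? H (a , b) c) λ (ok , _) → contradiction ok ¬ok) ⟩
        q * ∑ S (const 0)                           ≡⟨ cong (q *_) (∑-const S 0) ⟩
        q * (length S * 0)                          ≡⟨ cong (q *_) (*-zeroʳ (length S)) ⟩
        q * 0                                       ≡⟨ *-zeroʳ q ⟩
        0                                           ∎) (n≮n 0)
      where open ≤-Reasoning

  Mono : (Vertex G → Fin 3) → Vertex G × Vertex G → Set
  Mono c (a , b) = c a ≡ c b

  record Unavoidable (S₀ : List (Vertex G → Fin 3)) : Set where
    field
      {H}    : List (Vertex G × Vertex G)
      sparse : Sparse D H
      inside : All (_∈ edges G U) H
      kills  : ∀ {c} → c ∈ S₀ → Any (Mono c) H

  -- `f` counts the remaining steps and `S` holds the survivors; `S₀` stays fixed, each of its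
  -- colourings either surviving or having a monochromatic edge in `H`.
  process : ∀ {S₀ H} f S → Sparse D H → All (_∈ edges G U) H → length H + f ≡ t →
            (∀ {c} → c ∈ S₀ → c ∈ S ⊎ Any (Mono c) H) → length S * x ^ f < q ^ f → Unavoidable S₀
  process f [] sp inside _ cover _ = record
    { sparse = sp ; inside = inside ; kills = λ c∈ → dead (cover c∈) }
    where
    dead : ∀ {c H} → c ∈ [] ⊎ Any (Mono c) H → Any (Mono c) H
    dead (inj₂ mono) = mono
  -- With no steps left the decay bound says that `S` has length below 1.
  process zero (_ ∷ S) _ _ _ _ (s≤s ())
  process {S₀} {H} (suc f) S@(_ ∷ _) sp inside H+f≡t cover lt =
    continue (good-edge sp (≤-trans (m≤m+n _ _) (≤-reflexive H+f≡t)) S (s≤s z≤n))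
    where
    open Graph G using () renaming (adj-irrefl to ~-irrefl)

    survive : ∀ a b c → c ∈ S ⊎ Any (Mono c) H →
              c ∈ filter (λ c → ¬? (c a Fin.≟ c b)) S ⊎ Any (Mono c) ((a , b) ∷ H)
    survive a b c (inj₂ mono) = inj₂ (there mono)
    survive a b c (inj₁ c∈) with c a Fin.≟ c b
    ... | yes ca≡cb = inj₂ (here ca≡cb)
    ... | no  ca≢cb = inj₁ (∈-filter⁺ (λ c → ¬? (c a Fin.≟ c b)) c∈ ca≢cb)

    continue : ∃[ a ] ∃[ b ] ((a , b) ∈ edges G U × Allowed D H a b ×
                              length S ≤ q * ∑ S (λ c → 𝟙 (c a Fin.≟ c b))) → Unavoidable S₀
    continue (a , b , ab∈ , ok , S≤) =
      let _ , _ , _ , ab = ∈-edges⁻ G {U} ab∈ in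
      process f (filter (λ c → ¬? (c a Fin.≟ c b)) S)
        (add (λ a≡b → ~-irrefl a≡b ab) ok sp)
        (ab∈ ∷ inside)
        (trans (sym (+-suc (length H) f)) H+f≡t)
        (λ c∈ → survive a b _ (cover c∈))
        (survivors-decay (λ c → c a Fin.≟ c b) S q f S≤ lt)

  unavoidable : Unavoidable (colorings zero U)
  unavoidable = process t (colorings zero U) [] [] refl inj₁ (begin-strict
    length (colorings {r = 3} zero U) * x ^ t     ≡⟨ cong (_* x ^ t) (length-colorings {r = 3} zero U) ⟩
    3 ^ n * x ^ t                                 ≡⟨ cong (λ q → 3 ^ n * x ^ (q * (2 * n))) (suc-pred q) ⟨
    3 ^ n * x ^ (suc x * (2 * n))                 <⟨ extinction x n ⟩
    suc x ^ (suc x * (2 * n))                     ≡⟨ cong (λ q → q ^ (q * (2 * n))) (suc-pred q) ⟩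
    q ^ t                                         ∎)
    where open ≤-Reasoning

  realise : Unavoidable (colorings zero U) → ∃[ H ] (H ⊆ᴳ G × [ 5 ] ≤∞ girth H × 4 ≤ χ H)
  realise unavoidable = ⟨H⟩ , (id , (λ eq → eq) , adj) , girth≥5 ⟨H⟩ C₃ C₄ , ¬Colorable⇒<χ ⟨H⟩ ¬3-col
    where
    open Unavoidable unavoidable
    open Graph G using () renaming (Adj to _~_; adj-sym to ~-sym; adj-irrefl to ~-irrefl)

    adj : ∀ {u v} → v ∈ nb H u → u ~ v
    adj {u} {v} v∈ with nb⇒∈ H v∈
    ... | inj₁ uv∈ = let _ , _ , _ , uv = ∈-edges⁻ G {U} (All.lookup inside uv∈) in uv
    ... | inj₂ vu∈ = let _ , _ , _ , vu = ∈-edges⁻ G {U} (All.lookup inside vu∈) in ~-sym vu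

    ⟨H⟩ : Graph
    ⟨H⟩ = record
      { order      = order G
      ; Adj        = λ u v → v ∈ nb H u
      ; adj?       = λ u v → v ∈? nb H u
      ; adj-sym    = nb-sym H
      ; adj-irrefl = λ eq v∈ → ~-irrefl eq (adj v∈)
      }

    C₃ : ¬ HasCycle ⟨H⟩ 3
    C₃ (_ , c , inj , nx) = no-C₃ sparse
      (λ eq → contradiction (inj zero (suc zero) eq) λ ())
      (λ eq → contradiction (inj (suc zero) (suc (suc zero)) eq) λ ())
      (λ eq → contradiction (inj (suc (suc zero)) zero eq) λ ())
      (nx zero (suc zero) (inj₁ refl))
      (nx (suc zero) (suc (suc zero)) (inj₁ refl))
      (nx (suc (suc zero)) zero (inj₂ (refl , refl)))

    C₄ : ¬ HasCycle ⟨H⟩ 4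
    C₄ (_ , c , inj , nx) = no-C₄ sparse
      (λ eq → contradiction (inj zero (suc zero) eq) λ ())
      (λ eq → contradiction (inj (suc zero) (suc (suc zero)) eq) λ ())
      (λ eq → contradiction (inj (suc (suc zero)) (suc (suc (suc zero))) eq) λ ())
      (λ eq → contradiction (inj (suc (suc (suc zero))) zero eq) λ ())
      (λ eq → contradiction (inj zero (suc (suc zero)) eq) λ ())
      (λ eq → contradiction (inj (suc zero) (suc (suc (suc zero))) eq) λ ())
      (nx zero (suc zero) (inj₁ refl))
      (nx (suc zero) (suc (suc zero)) (inj₁ refl))
      (nx (suc (suc zero)) (suc (suc (suc zero))) (inj₁ refl))
      (nx (suc (suc (suc zero))) zero (inj₂ (refl , refl)))

    ¬3-col : ¬ Colorable ⟨H⟩ 3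
    ¬3-col (c , proper)
      -- The enumerated colouring may differ from `c` outside `U`, but the edge that kills it lies
      -- inside `U`.
      with c′ , c′∈ , agree ← colorings-complete zero U c
      with (u , v) , uv∈ , c′u≡c′v ← find (kills c′∈)
      with u∈ , v∈ , _ ← ∈-edges⁻ G {U} (All.lookup inside uv∈)
      = proper u v (∈⇒nb uv∈) (trans (sym (agree u∈)) (trans c′u≡c′v (agree v∈)))

  sparse-4-chromatic : ∃[ H ] (H ⊆ᴳ G × [ 5 ] ≤∞ girth H × 4 ≤ χ H)
  sparse-4-chromatic = realise unavoidable

-- Descent

-- For `D = 8 K²` this is `8 K² D³`, an upper bound for `4 K² (D² + D³)`.
threshold : ℕ → ℕ
threshold K = 4096 * K ^ 8

threshold-pos : ∀ K → .{{NonZero K}} → 0 < threshold K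
threshold-pos K = >-nonZero⁻¹ (threshold K) {{m*n≢0 4096 (K ^ 8) {{_}} {{m^n≢0 K 8}}}}

threshold-large : ∀ K D → .{{NonZero D}} → D ≡ 8 * (K * K) → 4 * (K * K) * (D * D + D * D * D) ≤ threshold K
threshold-large K D D≡ = begin
  4 * (K * K) * (D * D + D * D * D)           ≤⟨ *-monoʳ-≤ (4 * (K * K)) (+-monoˡ-≤ (D * D * D) (m≤m*n (D * D) D)) ⟩
  4 * (K * K) * (D * D * D + D * D * D)       ≡⟨ cong (λ D → 4 * (K * K) * (D * D * D + D * D * D)) D≡ ⟩
  _                                           ≡⟨ expand K ⟩
  threshold K                                 ∎
  where
  open ≤-Reasoning
  expand : ∀ K → 4 * (K * K) * (8 * (K * K) * (8 * (K * K)) * (8 * (K * K)) + 8 * (K * K) * (8 * (K * K)) * (8 * (K * K)))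
           ≡ 4096 * (K * (K * (K * (K * (K * (K * (K * (K * 1))))))))
  expand = solve-∀

descent : ∀ G K → .{{NonZero K}} → ∀ j {U} → Unique U → ¬ Col G U (4 ^ j * threshold K) →
          length U * length (edges G U) < K ^ j → ∃[ H ] (H ⊆ᴳ G × [ 5 ] ≤∞ girth H × 4 ≤ χ H)
-- Here `n m < 1`, so there is no edge and a single colour would do.
descent G K zero {U} uniq ¬col small = contradiction
  (Col-edgeless G U (subst (0 <_) (sym (*-identityˡ (threshold K))) (threshold-pos K)) λ u∈ v∈ uv →
    <⇒≱ small (*-mono-≤ (∈-length u∈) (edges-pos G u∈ v∈ uv)))
  ¬col
descent G K (suc j) {U} uniq ¬col small = cases (anySublist? poor? U)
  where
  k D : ℕ
  k = 4 ^ j * threshold K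
  D = 8 * (K * K)

  Poor : List (Vertex G) → Set
  Poor W = ¬ Col G W k × K * (length W * length (edges G W)) ≤ length U * length (edges G U)

  poor? : Decidable Poor
  poor? W = ¬? (col? G W k) ×-dec (_ ≤? _)

  D-nonZero : NonZero D
  D-nonZero = m*n≢0 8 (K * K) {{_}} {{m*n≢0 K K}}

  threshold≤k : threshold K ≤ k
  threshold≤k = m≤n*m (threshold K) (4 ^ j) {{m^n≢0 4 j}}

  cases : Dec (∃[ W ] (W ⊆ U × Poor W)) → ∃[ H ] (H ⊆ᴳ G × [ 5 ] ≤∞ girth H × 4 ≤ χ H)
  cases (yes (W , τ , ¬colW , poor)) = descent G K j (Unique-⊆ τ uniq) ¬colW
    (*-cancelˡ-< K _ _ (≤-<-trans poor small))
  cases (no ¬poor) = Greedy.sparse-4-chromatic G uniq {K} {k} {D}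
    (<-≤-trans (threshold-pos K) threshold≤k)
    ≤-refl
    (≤-trans (threshold-large K D {{D-nonZero}} refl) threshold≤k)
    (subst (λ l → ¬ Col G U l) (*-assoc 4 (4 ^ j) (threshold K)) ¬col)
    (λ {W} τ ¬colW → ≰⇒> λ poor → ¬poor (W , τ , ¬colW , poor))

-- Integer roots and the choice of the scale

root : ∀ b .{{_ : NonZero b}} x → ∃[ K ] (K ^ b ≤ x × x < suc K ^ b)
root (suc b) zero = 0 , z≤n , >-nonZero⁻¹ (1 ^ suc b) {{m^n≢0 1 (suc b)}}
-- Increasing the radicand by one increases the root by at most one.
root b (suc x) with K , K≤ , <K ← root b x with suc x <? suc K ^ b
... | yes <K′ = K , m≤n⇒m≤1+n K≤ , <K′
... | no  ≮K  = suc K , ≮⇒≥ ≮K , ≤-<-trans <K (^-monoˡ-< b (n<1+n (suc K)))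

root-large : ∀ b {K L x} → L ^ b ≤ x → x < suc K ^ b → L ≤ K
root-large b L≤x x<K = ≮⇒≥ λ K<L → <⇒≱ x<K (≤-trans (^-monoˡ-≤ b K<L) L≤x)

few-edges⇒sparse-4-chromatic : ∀ a c → ∃[ M ] (∀ G → M ≤ χ G → e G ≤ c * suc (χ G ^ a) →
  ∃[ H ] (H ⊆ᴳ G × [ 5 ] ≤∞ girth H × 4 ≤ χ H))
few-edges⇒sparse-4-chromatic a c = L ^ 9 , λ G M≤χ e≤ →
  let K , K≤χ , χ<K = root 9 (χ G) in sparse G K K≤χ χ<K (root-large 9 {K} {L} M≤χ χ<K) e≤
  where
  R L : ℕ
  -- K ^ 9 ≤ χ < (K + 1) ^ 9 ≤ K ^ 18, and n m is at most quadratic in e.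
  R = suc (18 * a * 2)
  -- From `L` on, `suc K ≤ K ^ 2`, and one factor `K` exceeds both the constant `8 c²` of `few` and
  -- the loss `2 * 4 ^ R * 4096` of `colours`.
  L = 2 + (8 * (c * c) + 4 ^ R * 8192)

  sparse : ∀ G K → K ^ 9 ≤ χ G → χ G < suc K ^ 9 → L ≤ K → e G ≤ c * suc (χ G ^ a) →
           ∃[ H ] (H ⊆ᴳ G × [ 5 ] ≤∞ girth H × 4 ≤ χ H)
  sparse G K K≤χ χ<K L≤K e≤ = descent G K R
    (Unique-⊆ (filter-⊆ _ (allFin (order G))) (allFin⁺ (order G)))
    (¬Col-core G (allFin (order G)) (<-≤-trans (threshold-pos K) threshold≤) (≤-trans (threshold-pos K) threshold≤) ¬col)
    few
    where
    open ≤-Reasoning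
    instance
      K-nonZero : NonZero K
      K-nonZero = >-nonZero (≤-trans (s≤s z≤n) L≤K)

    -- Without isolated vertices the order is at most twice the number of edges, so that a bound on
    -- edges alone controls `n m`. The price is the factor 2 in `colours`.
    U : List (Vertex G)
    U = core G 1 (allFin (order G))

    threshold≤ : threshold K ≤ 4 ^ R * threshold K
    threshold≤ = m≤n*m (threshold K) (4 ^ R) {{m^n≢0 4 R}}

    -- The ninth root is taken because `threshold` has degree 8: the ninth factor `K` pays for the
    -- constants.
    colours : 2 * (4 ^ R * threshold K) < χ G
    colours = begin-strict
      2 * (4 ^ R * (4096 * K ^ 8))    ≡⟨ regroup (4 ^ R) (K ^ 8) ⟩
      4 ^ R * 8192 * K ^ 8            <⟨ *-monoˡ-< (K ^ 8) {{m^n≢0 K 8}} (≤-trans (s≤s (m≤n+m _ (suc (8 * (c * c))))) L≤K) ⟩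
      K * K ^ 8                       ≤⟨ K≤χ ⟩
      χ G                             ∎
      where
      regroup : ∀ r p → 2 * (r * (4096 * p)) ≡ r * 8192 * p
      regroup = solve-∀

    ¬col : ¬ Col G (allFin (order G)) (2 * (4 ^ R * threshold K))
    ¬col (c , proper) = <⇒≱ colours
      (χ-least G (c , λ u v uv → proper u v (uv , ∈-allFin u , ∈-allFin v)))

    χ-pos : 1 ≤ χ G
    χ-pos = ≤-trans (s≤s z≤n) colours

    χ≤K¹⁸ : χ G ≤ K ^ 18
    χ≤K¹⁸ = begin
      χ G             ≤⟨ <⇒≤ χ<K ⟩
      suc K ^ 9       ≤⟨ ^-monoˡ-≤ 9 sucK≤K² ⟩
      (K ^ 2) ^ 9     ≡⟨ ^-*-assoc K 2 9 ⟩
      K ^ 18          ∎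
      where
      sucK≤K² : suc K ≤ K ^ 2
      sucK≤K² = begin
        suc K         ≤⟨ +-monoˡ-≤ K (>-nonZero⁻¹ K) ⟩
        K + K         ≡⟨ cong (K +_) (+-identityʳ K) ⟨
        2 * K         ≤⟨ *-monoˡ-≤ K (≤-trans (m≤m+n 2 _) L≤K) ⟩
        K * K         ≡⟨ cong (K *_) (*-identityʳ K) ⟨
        K ^ 2         ∎

    e≤K : e G ≤ 2 * c * K ^ (18 * a)
    e≤K = begin
      e G                       ≤⟨ e≤ ⟩
      c * suc (χ G ^ a)         ≤⟨ *-monoʳ-≤ c (+-monoˡ-≤ (χ G ^ a) (>-nonZero⁻¹ (χ G ^ a) {{m^n≢0 (χ G) a {{>-nonZero χ-pos}}}})) ⟩
      c * (χ G ^ a + χ G ^ a)   ≡⟨ regroup c (χ G ^ a) ⟩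
      2 * c * χ G ^ a           ≤⟨ *-monoʳ-≤ (2 * c) (^-monoˡ-≤ a χ≤K¹⁸) ⟩
      2 * c * (K ^ 18) ^ a      ≡⟨ cong (2 * c *_) (^-*-assoc K 18 a) ⟩
      2 * c * K ^ (18 * a)      ∎
      where
      regroup : ∀ c x → c * (x + x) ≡ 2 * c * x
      regroup = solve-∀

    -- `n m ≤ 2 e² ≤ 8 c² K ^ (36 a)`, and the `suc` in `R` supplies the factor `K` that exceeds
    -- `8 c²`.
    few : length U * length (edges G U) < K ^ R
    few = begin-strict
      length U * length (edges G U)
        ≤⟨ *-mono-≤ (≤-trans (≤-reflexive (sym (*-identityˡ _))) (∣core∣ G 1 (allFin (order G))))
                    (length-mono-≤ (edges-⊆ G (filter-⊆ _ (allFin (order G))))) ⟩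
      2 * e G * e G
        ≤⟨ *-mono-≤ (*-monoʳ-≤ 2 e≤K) e≤K ⟩
      2 * (2 * c * K ^ (18 * a)) * (2 * c * K ^ (18 * a))
        ≡⟨ regroup c (K ^ (18 * a)) ⟩
      8 * (c * c) * (K ^ (18 * a)) ^ 2
        ≡⟨ cong (8 * (c * c) *_) (^-*-assoc K (18 * a) 2) ⟩
      8 * (c * c) * K ^ (18 * a * 2)
        <⟨ *-monoˡ-< (K ^ (18 * a * 2)) {{m^n≢0 K (18 * a * 2)}} (≤-trans (s≤s (m≤n⇒m≤1+n (m≤m+n (8 * (c * c)) (4 ^ R * 8192)))) L≤K) ⟩
      K * K ^ (18 * a * 2) ∎
      where
      regroup : ∀ c p → 2 * (2 * c * p) * (2 * c * p) ≡ 8 * (c * c) * (p * (p * 1))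
      regroup = solve-∀

-- Natural numbers among the rationals

-- `fromℕ` normalises its fraction; as an unnormalised rational it visibly has denominator 1, which
-- reduces order and products to integers.
toℚᵘ-fromℕ : ∀ n → toℚᵘ (fromℕ n) ℚᵘ.≃ mkℚᵘ (ℤ.+ n) 0
toℚᵘ-fromℕ n = ℚ.toℚᵘ-fromℚᵘ (mkℚᵘ (ℤ.+ n) 0)

fromℕ-cancel-≤ : ∀ {m n} → fromℕ m ℚ.≤ fromℕ n → m ≤ n
fromℕ-cancel-≤ {m} {n} le with ℚᵘ.drop-*≤* (ℚᵘ.≤-respʳ-≃ (toℚᵘ-fromℕ n) (ℚᵘ.≤-respˡ-≃ (toℚᵘ-fromℕ m) (ℚ.toℚᵘ-mono-≤ le)))
... | le′ = ℤ.drop‿+≤+ (subst₂ ℤ._≤_ (ℤ.*-identityʳ (ℤ.+ m)) (ℤ.*-identityʳ (ℤ.+ n)) le′)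

fromℕ-mono-< : ∀ {m n} → m < n → fromℕ m ℚ.< fromℕ n
fromℕ-mono-< {m} {n} m<n = ℚ.toℚᵘ-cancel-<
  (ℚᵘ.<-respʳ-≃ (ℚᵘ.≃-sym (toℚᵘ-fromℕ n)) (ℚᵘ.<-respˡ-≃ (ℚᵘ.≃-sym (toℚᵘ-fromℕ m))
    (ℚᵘ.*<* (subst₂ ℤ._<_ (sym (ℤ.*-identityʳ (ℤ.+ m))) (sym (ℤ.*-identityʳ (ℤ.+ n))) (+<+ m<n)))))

fromℕ-* : ∀ m n → fromℕ m ℚ.* fromℕ n ≡ fromℕ (m * n)
fromℕ-* m n = ℚ.toℚᵘ-injective (begin
  toℚᵘ (fromℕ m ℚ.* fromℕ n)             ≈⟨ ℚ.toℚᵘ-homo-* (fromℕ m) (fromℕ n) ⟩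
  toℚᵘ (fromℕ m) ℚᵘ.* toℚᵘ (fromℕ n)     ≈⟨ ℚᵘ.*-cong (toℚᵘ-fromℕ m) (toℚᵘ-fromℕ n) ⟩
  mkℚᵘ (ℤ.+ m) 0 ℚᵘ.* mkℚᵘ (ℤ.+ n) 0         ≈⟨ ℚᵘ.*≡* (cong (ℤ._* ℤ.+ 1) (sym (ℤ.pos-* m n))) ⟩
  mkℚᵘ (ℤ.+ (m * n)) 0                     ≈⟨ toℚᵘ-fromℕ (m * n) ⟨
  toℚᵘ (fromℕ (m * n))                   ∎)
  where open ℚᵘ.≃-Reasoning

fromℕ-^ : ∀ n k → fromℕ n ^ℚ k ≡ fromℕ (n ^ k)
fromℕ-^ n zero    = refl
fromℕ-^ n (suc k) = trans (cong (fromℕ n ℚ.*_) (fromℕ-^ n k)) (fromℕ-* n (n ^ k))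

-- Dropping a denominator of at least 1 does not decrease a nonnegative fraction, and a negative one
-- lies below any natural number.
≤-fromℕ-∣↥∣ : ∀ q → q ℚ.≤ fromℕ ℤ.∣ ↥ q ∣
≤-fromℕ-∣↥∣ q = ℚ.toℚᵘ-cancel-≤ (ℚᵘ.≤-respʳ-≃ (ℚᵘ.≃-sym (toℚᵘ-fromℕ ℤ.∣ ↥ q ∣)) (numerator q))
  where
  numerator : ∀ q → toℚᵘ q ℚᵘ.≤ mkℚᵘ (ℤ.+ ℤ.∣ ↥ q ∣) 0
  numerator (ℚ.mkℚ (ℤ.+ n) d _) = ℚᵘ.*≤* (subst₂ ℤ._≤_ (ℤ.pos-* n 1) (ℤ.pos-* n (suc d))
    (+≤+ (*-monoʳ-≤ n (s≤s z≤n))))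
  numerator (ℚ.mkℚ ℤ.-[1+ n ] d _) = ℚᵘ.*≤* -≤+

-- One rational `p = a / b` above `P` and one `γ` above `C` suffice. Taking `y = n ^ a + 1` gives
-- `n ^ a < y ≤ y ^ b`, so `y` is in the upper cut of `n ^ P`, and `γ` is rounded up to `c`.
≤ᵁ⇒polynomial : (P C : ℝ) → ∃[ a ] ∃[ c ] (∀ {n m} → fromℕ m ≤ᵁ C *ᵁ n ^ᵁ P → m ≤ c * suc (n ^ a))
≤ᵁ⇒polynomial P C = a , c , λ {n} {m} m≤ → fromℕ-cancel-≤ (begin
  fromℕ m                              ≤⟨ m≤ (γ , y n , γ∈ , y∈ n , refl) ⟩
  γ ℚ.* y n                            ≤⟨ ℚ.*-monoʳ-≤-nonNeg (y n) {{y-nonNeg n}} (≤-fromℕ-∣↥∣ γ) ⟩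
  fromℕ c ℚ.* y n                      ≡⟨ fromℕ-* c (suc (n ^ a)) ⟩
  fromℕ (c * suc (n ^ a))              ∎)
  where
  open ℚ.≤-Reasoning
  p = proj₁ (ℝ.upper-inhabited P)
  p∈ = proj₂ (ℝ.upper-inhabited P)
  γ = proj₁ (ℝ.upper-inhabited C)
  γ∈ = proj₂ (ℝ.upper-inhabited C)
  a = ℤ.∣ ↥ p ∣
  c = ℤ.∣ ↥ γ ∣

  y : ℕ → ℚ
  y n = fromℕ (suc (n ^ a))

  0<y : ∀ n → 0ℚ ℚ.< y n
  0<y n = fromℕ-mono-< {0} {suc (n ^ a)} (s≤s z≤n)

  y-nonNeg : ∀ n → ℚ.NonNegative (y n)
  y-nonNeg n = ℚ.nonNegative (ℚ.<⇒≤ (0<y n))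

  y∈ : ∀ n → (n ^ᵁ P) (y n)
  y∈ n = 0<y n , p , p∈ , subst₂ ℚ._<_ (sym (fromℕ-^ n a)) (sym (fromℕ-^ (suc (n ^ a)) (↧ₙ p)))
    (fromℕ-mono-< (m≤m*n (suc (n ^ a)) (suc (n ^ a) ^ ℚ.ℚ.denominator-1 p) {{m^n≢0 (suc (n ^ a)) (ℚ.ℚ.denominator-1 p)}}))

corollary1p2 : (P C : ℝ) → Positive P → Positive C →
    (∃[ M ] ((G : Graph) → M ≤ χ G → fromℕ (e G) ≤ᵁ C *ᵁ χ G ^ᵁ P →
    ∃[ H ] (H ⊆ᴳ G × [ 5 ] ≤∞ girth H × 4 ≤ χ H)))
    ×
    (∃[ M ] ((G : Graph) → TriangleFree G → M ≤ χ G → fromℕ (e G) ≤ᵁ C *ᵁ χ G ^ᵁ P →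
    ∃[ H ] (H ⊆ᴳ G × C₄-Free H × χ H ≡ 4)))
corollary1p2 P C _ _ =
  let a , c , polynomial = ≤ᵁ⇒polynomial P C
      M , sparse = few-edges⇒sparse-4-chromatic a c
  in (M , λ G M≤χ e≤ → sparse G M≤χ (polynomial e≤))
   , (M , λ G _ M≤χ e≤ →
       -- The chromatic number of `H` may exceed 4; its 4-chromatic subgraph `H′` inherits
       -- `C₄`-freeness.
       let H , H⊆G , 5≤girth , 4≤χ = sparse G M≤χ (polynomial e≤)
           H′ , H′⊆H , χ≡4 = exactly-4-chromatic H 4≤χ
       in H′ , ⊆ᴳ-trans {H′} {H} {G} H′⊆H H⊆G
             , C₄-Free-⊆ᴳ {H′} {H} H′⊆H (girth≥5⇒C₄-Free H 5≤girth) , χ≡4)
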